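{- Let $n$ be an even integer and let $C_n$ be the cycle on $n$ vertices. Then $\widetilde{r}_{ind}(C_n) \le 367n-27$.
   Context: The online Ramsey game for a target graph $H$ is played between Builder and Painter on an infinite set of vertices, initially with no edges. In each round Builder adds a new edge between two vertices (forming the background graph $G$), and Painter immediately colors that edge red or blue. The induced online Ramsey number $\widetilde{r}_{ind}(H)$ is the minimum number $m$ such that Builder has a strategy guaranteeing that, against any Painter strategy, after at most $m$ rounds there is a monochromatic induced copy of $H$ in $G$, i.e. a vertex set $S$ such that the subgraph of $G$ induced on $S$ is isomorphic to $H$ and all its edges have the same color ($\infty$ if no such strategy exists). -}

module Defs where

open import Data.Nat using (ℕ; zero; suc; _+_; _%_)
open import Data.Fin using (Fin; toℕ)
open import Data.List using (List; _∷_; [])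
open import Data.List.Relation.Unary.Any using (Any)
open import Data.Product using (Σ; ∃; _×_; _,_)
open import Data.Sum using (_⊎_)
open import Relation.Binary.PropositionalEquality using (_≡_; _≢_)
open import Relation.Nullary using (¬_)
open import Function.Definitions using (Injective)

data Colour : Set where
  red blue : Colour

record CEdge : Set where
  constructor edge
  field
    u v : ℕ
    col : Colour

-- The current position: the background graph G on vertex set ℕ,
-- with Painter's colouring, given as the list of coloured edges built so far.
ColGraph : Set
ColGraph = List CEdge

Joins : CEdge → ℕ → ℕ → Set
Joins (edge u v _) x y = (u ≡ x × v ≡ y) ⊎ (u ≡ y × v ≡ x)

Adj : ColGraph → ℕ → ℕ → Set
Adj G x y = Any (λ e → Joins e x y) G

AdjCol : ColGraph → Colour → ℕ → ℕ → Set
AdjCol G c x y = Any (λ e → CEdge.col e ≡ c × Joins e x y) G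

CycAdj : (n : ℕ) → Fin n → Fin n → Set
CycAdj n i j = (suc (toℕ i) % suc (pred' n) ≡ toℕ j) ⊎ (suc (toℕ j) % suc (pred' n) ≡ toℕ i)
  where
  pred' : ℕ → ℕ
  pred' zero = zero
  pred' (suc k) = k

MonoInducedCycle : ℕ → ColGraph → Set
MonoInducedCycle n G =
  Σ Colour λ c → Σ (Fin n → ℕ) λ f →
    Injective _≡_ _≡_ f
    × (∀ i j → CycAdj n i j → AdjCol G c (f i) (f j))
    × (∀ i j → Adj G (f i) (f j) → CycAdj n i j)

-- BuilderWins n m G : from position G, Builder has a strategy guaranteeing a
-- monochromatic induced C_n within at most m further rounds, against every
-- (adaptive) Painter strategy. Each round Builder adds a new edge xy
-- (x ≠ y, not yet present) and Painter may colour it either way.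
data BuilderWins (n : ℕ) : ℕ → ColGraph → Set where
  done : ∀ {m G} → MonoInducedCycle n G → BuilderWins n m G
  step : ∀ {m G} (x y : ℕ) → x ≢ y → ¬ Adj G x y →
         (∀ c → BuilderWins n m (edge x y c ∷ G)) →
         BuilderWins n (suc m) G

IndOnlineRamseyCycle≤ : ℕ → ℕ → Set
IndOnlineRamseyCycle≤ n m = BuilderWins n m []

{-# OPTIONS --safe #-}
module Submission where

-- Write n = 4 + 2h and d = n − 2; the bound 367n − 27 is obtained in two stages.
--
-- A long monochromatic induced path. Keep an induced path in each colour, every vertex v
-- carrying some ports: leaves pendant at v in the colour of the path. Join a port x of the
-- last red vertex with ports to a port y of the last blue vertex with ports. If xy is red,
-- then y is attached to both paths (to the red one through x), so give y new leaves until
-- four of them have the same colour, and extend the path of that colour to y; symmetrically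
-- with x if xy is blue. Each such exchange takes at most 8 edges and creates two more ports
-- than it uses, while all but the last vertex of a path have at most 3 ports; so the paths
-- together grow by one vertex per 12 edges.
--
-- A cycle. Let P be an induced path of colour c, and c′ the other colour. Builder joins new
-- vertices to vertices of P so as to make an induced c′-cycle alternating between the two.
-- A new vertex joined in c to P q and P (q + d) closes a c-cycle of length n, and so do
-- two new vertices joined in c to P q and P (q + 2d), respectively to P (q + h) and
-- P (q + 2d + h), because 2h + 4 = n; this is where n must be even. Hence among the four rows
-- q, q + d, q + 2d, q + 3d a new vertex either has two consecutive c′-edges, and then it shares
-- a c′-neighbour with any further vertex, or its c-edges alternate, and then of three rows
-- shifted by h every further vertex has at least two in c′, so any two of them share
-- a c′-neighbour. The n/2 links of the cycle are laid out on P so as not to interfere.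

open import Defs
open import Data.Fin using (Fin; toℕ)
open import Data.Fin.Properties using (toℕ<n; toℕ-injective)
open import Data.List using (List; []; _∷_; _++_; length; map)
open import Data.List.Membership.Propositional using (_∈_; _∉_)
open import Data.List.Membership.Propositional.Properties using (∈-++⁺ˡ; ∈-++⁺ʳ; ∈-++⁻)
open import Data.List.Relation.Unary.All as All using (All; []; _∷_)
open import Data.List.Relation.Unary.AllPairs using ([]; _∷_)
open import Data.List.Relation.Unary.Any as Any using (here; there)
open import Data.List.Relation.Unary.Unique.Propositional using (Unique)
import Data.List.Relation.Unary.Unique.Propositional.Properties as Unique
open import Data.Nat
open import Data.Nat.Divisibility using (_∣_; divides)
open import Data.Nat.DivMod using (m<n⇒m%n≡m; n%n≡0; m≡m%n+[m/n]*n; m%n<n; m/n*n≤m; /-monoˡ-≤)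
open import Data.Nat.Properties
open import Data.Nat.Tactic.RingSolver using (solve-∀)
open import Data.Product using (∃; ∃₂; _×_; _,_; proj₁; proj₂)
open import Data.Sum as Sum using (_⊎_; inj₁; inj₂)
open import Data.Unit using (⊤; tt)
open import Function using (_∘_; id)
open import Relation.Binary.Definitions using (tri<; tri≈; tri>)
open import Relation.Binary.PropositionalEquality
open import Relation.Nullary using (¬_; yes; no; contradiction)

-- Induced paths and cycles

adj-sym : ∀ {G x y} → Adj G x y → Adj G y x
adj-sym = Any.map Sum.swap

adjCol-sym : ∀ {G c x y} → AdjCol G c x y → AdjCol G c y x
adjCol-sym = Any.map λ (p , q) → p , Sum.swap q

Loopless : ColGraph → Set
Loopless G = ∀ {x} → ¬ Adj G x x

weaken : ∀ {n m m′ G} → m ≤ m′ → BuilderWins n m G → BuilderWins n m′ G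
weaken _ (done cyc) = done cyc
weaken (s≤s m≤m′) (step x y x≢y new next) = step x y x≢y new λ c → weaken m≤m′ (next c)

-- Hypotheses are needed only for `i < j`: symmetry gives the other order and `Loopless` the
-- diagonal. The edge from `f m` to `f 0` is the one place where the residue in `CycAdj` wraps
-- around.
cycle-of-sequence : ∀ {G c} m (f : ℕ → ℕ) → Loopless G →
  (∀ i → i < m → AdjCol G c (f i) (f (suc i))) → AdjCol G c (f m) (f 0) →
  (∀ i j → i < j → j ≤ m → f i ≢ f j) →
  (∀ i j → i < j → j ≤ m → Adj G (f i) (f j) → j ≡ suc i ⊎ (i ≡ 0 × j ≡ m)) →
  MonoInducedCycle (suc m) G
cycle-of-sequence {G} {c} m f loopless edges closing distinct induced =
  c , f ∘ toℕ , injective , (λ i j → Sum.[ edge-of i j , adjCol-sym ∘ edge-of j i ]) , cyclic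
  where
  bound : (i : Fin (suc m)) → toℕ i ≤ m
  bound i = s≤s⁻¹ (toℕ<n i)

  next-step : ∀ {i} → i < m → suc i % suc m ≡ suc i
  next-step i<m = m<n⇒m%n≡m (s≤s i<m)

  injective : ∀ {i j : Fin (suc m)} → f (toℕ i) ≡ f (toℕ j) → i ≡ j
  injective {i} {j} eq with <-cmp (toℕ i) (toℕ j)
  ... | tri< i<j _ _ = contradiction eq (distinct _ _ i<j (bound j))
  ... | tri≈ _ i≡j _ = toℕ-injective i≡j
  ... | tri> _ _ j<i = contradiction (sym eq) (distinct _ _ j<i (bound i))

  edge-of : ∀ (i j : Fin (suc m)) → suc (toℕ i) % suc m ≡ toℕ j →
    AdjCol G c (f (toℕ i)) (f (toℕ j))
  edge-of i j eq with m≤n⇒m<n∨m≡n (bound i)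
  ... | inj₁ i<m = subst (AdjCol G c (f (toℕ i)) ∘ f) (trans (sym (next-step i<m)) eq) (edges _ i<m)
  ... | inj₂ i≡m = subst₂ (λ a b → AdjCol G c (f a) (f b)) (sym i≡m)
    (trans (sym (n%n≡0 (suc m))) (trans (cong (λ a → suc a % suc m) (sym i≡m)) eq)) closing

  succ-of : ∀ (i j : Fin (suc m)) → toℕ i < toℕ j → Adj G (f (toℕ i)) (f (toℕ j)) → CycAdj (suc m) i j
  succ-of i j i<j adj with induced _ _ i<j (bound j) adj
  ... | inj₁ j≡1+i = inj₁ (trans (next-step (<-≤-trans i<j (bound j))) (sym j≡1+i))
  ... | inj₂ (i≡0 , j≡m) = inj₂ (trans (cong (λ a → suc a % suc m) j≡m) (trans (n%n≡0 (suc m)) (sym i≡0)))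

  cyclic : ∀ i j → Adj G (f (toℕ i)) (f (toℕ j)) → CycAdj (suc m) i j
  cyclic i j adj with <-cmp (toℕ i) (toℕ j)
  ... | tri< i<j _ _ = succ-of i j i<j adj
  ... | tri≈ _ i≡j _ = contradiction (subst (λ a → Adj G (f (toℕ i)) (f a)) (sym i≡j) adj) loopless
  ... | tri> _ _ j<i = Sum.swap (succ-of j i j<i (adj-sym adj))

-- A total function of which only the first `m` values matter, so that segments, reversals and
-- concatenations are plain reindexings.
record InducedPath (G : ColGraph) (c : Colour) (f : ℕ → ℕ) (m : ℕ) : Set where
  field
    edges    : ∀ i → suc i < m → AdjCol G c (f i) (f (suc i))
    distinct : ∀ i j → i < j → j < m → f i ≢ f j
    induced  : ∀ i j → i < j → j < m → Adj G (f i) (f j) → j ≡ suc i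
open InducedPath

cons : ℕ → (ℕ → ℕ) → ℕ → ℕ
cons v f zero    = v
cons v f (suc i) = f i

cons-path : ∀ {G c v f m} → InducedPath G c f m → (0 < m → AdjCol G c v (f 0)) →
  (∀ i → i < m → v ≢ f i) → (∀ i → i < m → Adj G v (f i) → i ≡ 0) →
  InducedPath G c (cons v f) (suc m)
cons-path path start fresh only .edges zero (s≤s 0<m) = start 0<m
cons-path path start fresh only .edges (suc i) (s≤s i<m) = path .edges i i<m
cons-path path start fresh only .distinct zero (suc j) _ (s≤s j<m) = fresh j j<m
cons-path path start fresh only .distinct (suc i) (suc j) (s≤s i<j) (s≤s j<m) = path .distinct i j i<j j<m
cons-path path start fresh only .induced zero (suc j) _ (s≤s j<m) adj = cong suc (only j j<m adj)
cons-path path start fresh only .induced (suc i) (suc j) (s≤s i<j) (s≤s j<m) adj =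
  cong suc (path .induced i j i<j j<m adj)

close-path : ∀ {G c f m} v → Loopless G → InducedPath G c f (suc m) →
  AdjCol G c v (f 0) → AdjCol G c v (f m) →
  (∀ i → i ≤ m → v ≢ f i) → (∀ i → i ≤ m → Adj G v (f i) → i ≡ 0 ⊎ i ≡ m) →
  MonoInducedCycle (suc (suc m)) G
close-path {G} {c} {f} {m} v loopless path first last fresh only =
  cycle-of-sequence (suc m) (cons v f) loopless edges′ (adjCol-sym last) distinct′ induced′
  where
  edges′ : ∀ i → i < suc m → AdjCol G c (cons v f i) (f i)
  edges′ zero    _   = first
  edges′ (suc i) i<m = path .edges i i<m

  distinct′ : ∀ i j → i < j → j ≤ suc m → cons v f i ≢ cons v f j
  distinct′ zero    (suc j) _         (s≤s j≤m) = fresh j j≤m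
  distinct′ (suc i) (suc j) (s≤s i<j) (s≤s j≤m) = path .distinct i j i<j (s≤s j≤m)

  induced′ : ∀ i j → i < j → j ≤ suc m → Adj G (cons v f i) (cons v f j) →
    j ≡ suc i ⊎ (i ≡ 0 × j ≡ suc m)
  induced′ zero    (suc j) _         (s≤s j≤m) adj =
    Sum.map (cong suc) (λ j≡m → refl , cong suc j≡m) (only j j≤m adj)
  induced′ (suc i) (suc j) (s≤s i<j) (s≤s j≤m) adj =
    inj₁ (cong suc (path .induced i j i<j (s≤s j≤m) adj))

append : ℕ → (ℕ → ℕ) → (ℕ → ℕ) → ℕ → ℕ
append zero    f g i       = g i
append (suc k) f g zero    = f 0
append (suc k) f g (suc i) = append k (f ∘ suc) g i

append-left : ∀ k f g {i} → i < k → append k f g i ≡ f i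
append-left (suc k) f g {zero}  _         = refl
append-left (suc k) f g {suc i} (s≤s i<k) = append-left k (f ∘ suc) g i<k

append-right : ∀ k f g i → append k f g (k + i) ≡ g i
append-right zero    f g i = refl
append-right (suc k) f g i = append-right k (f ∘ suc) g i

split : ∀ k i → i < k ⊎ ∃ λ j → i ≡ k + j
split k i with i <? k
... | yes i<k = inj₁ i<k
... | no  i≮k = inj₂ (i ∸ k , sym (m+[n∸m]≡n (≮⇒≥ i≮k)))

append-path : ∀ {G c} k {f g m} → InducedPath G c f (suc k) → InducedPath G c g m →
  (0 < m → AdjCol G c (f k) (g 0)) →
  (∀ i j → i ≤ k → j < m → f i ≢ g j) →
  (∀ i j → i ≤ k → j < m → Adj G (f i) (g j) → i ≡ k × j ≡ 0) →
  InducedPath G c (append (suc k) f g) (suc k + m)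
append-path {G} {c} k {f} {g} {m} pf pg join apart only = record
  { edges = edges′ ; distinct = distinct′ ; induced = induced′ }
  where
  h : ℕ → ℕ
  h = append (suc k) f g

  left : ∀ {i} → i ≤ k → f i ≡ h i
  left i≤k = sym (append-left (suc k) f g (s≤s i≤k))

  right : ∀ i → g i ≡ h (suc k + i)
  right i = sym (append-right (suc k) f g i)

  edges′ : ∀ i → suc i < suc k + m → AdjCol G c (h i) (h (suc i))
  edges′ i i<k+m with split (suc k) i
  ... | inj₂ (j , refl) = subst₂ (AdjCol G c) (right j) (trans (right (suc j)) (cong h (+-suc (suc k) j)))
    (pg .edges j (+-cancelˡ-< (suc k) _ _ (subst (_< suc k + m) (sym (+-suc (suc k) j)) i<k+m)))
  ... | inj₁ (s≤s i≤k) with m≤n⇒m<n∨m≡n i≤k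
  ...   | inj₁ i<k = subst₂ (AdjCol G c) (left i≤k) (left i<k) (pf .edges i (s≤s i<k))
  ...   | inj₂ refl = subst₂ (AdjCol G c) (left i≤k) (trans (right 0) (cong h (+-identityʳ (suc k))))
    (join (+-cancelˡ-< (suc k) _ _ (subst (_< suc k + m) (sym (+-identityʳ (suc k))) i<k+m)))

  distinct′ : ∀ i j → i < j → j < suc k + m → h i ≢ h j
  distinct′ i j i<j j<k+m with split (suc k) i | split (suc k) j
  ... | inj₁ (s≤s i≤k) | inj₁ (s≤s j≤k) = subst₂ _≢_ (left i≤k) (left j≤k) (pf .distinct i j i<j (s≤s j≤k))
  ... | inj₁ (s≤s i≤k) | inj₂ (j′ , refl) = subst₂ _≢_ (left i≤k) (right j′)
    (apart i j′ i≤k (+-cancelˡ-< (suc k) _ _ j<k+m))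
  ... | inj₂ (i′ , refl) | inj₁ j<k = contradiction (≤-<-trans (m≤m+n (suc k) i′) (<-trans i<j j<k)) (<-irrefl refl)
  ... | inj₂ (i′ , refl) | inj₂ (j′ , refl) = subst₂ _≢_ (right i′) (right j′)
    (pg .distinct i′ j′ (+-cancelˡ-< (suc k) _ _ i<j) (+-cancelˡ-< (suc k) _ _ j<k+m))

  induced′ : ∀ i j → i < j → j < suc k + m → Adj G (h i) (h j) → j ≡ suc i
  induced′ i j i<j j<k+m adj with split (suc k) i | split (suc k) j
  ... | inj₁ (s≤s i≤k) | inj₁ (s≤s j≤k) =
    pf .induced i j i<j (s≤s j≤k) (subst₂ (Adj G) (sym (left i≤k)) (sym (left j≤k)) adj)
  ... | inj₁ (s≤s i≤k) | inj₂ (j′ , refl)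
    with refl , refl ← only i j′ i≤k (+-cancelˡ-< (suc k) _ _ j<k+m)
                         (subst₂ (Adj G) (sym (left i≤k)) (sym (right j′)) adj) = +-identityʳ (suc k)
  ... | inj₂ (i′ , refl) | inj₁ j<k = contradiction (≤-<-trans (m≤m+n (suc k) i′) (<-trans i<j j<k)) (<-irrefl refl)
  ... | inj₂ (i′ , refl) | inj₂ (j′ , refl) = trans (cong (suc k +_)
    (pg .induced i′ j′ (+-cancelˡ-< (suc k) _ _ i<j) (+-cancelˡ-< (suc k) _ _ j<k+m)
      (subst₂ (Adj G) (sym (right i′)) (sym (right j′)) adj))) (+-suc (suc k) i′)

segment-path : ∀ {G c f k} q {m} → InducedPath G c f k → q + m ≤ k →
  InducedPath G c (λ t → f (q + t)) m
segment-path {G} {c} {f} {k} q path q+m≤k .edges i i<m = subst (AdjCol G c (f (q + i)) ∘ f) (sym (+-suc q i))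
  (path .edges (q + i) (subst (_≤ k) (cong suc (+-suc q i)) (<-≤-trans (+-monoʳ-< q i<m) q+m≤k)))
segment-path q path q+m≤k .distinct i j i<j j<m =
  path .distinct (q + i) (q + j) (+-monoʳ-< q i<j) (<-≤-trans (+-monoʳ-< q j<m) q+m≤k)
segment-path q path q+m≤k .induced i j i<j j<m adj = +-cancelˡ-≡ q _ _ (trans
  (path .induced (q + i) (q + j) (+-monoʳ-< q i<j) (<-≤-trans (+-monoʳ-< q j<m) q+m≤k) adj) (sym (+-suc q i)))

reverse-path : ∀ {G c f k} → InducedPath G c f (suc k) → InducedPath G c (λ i → f (k ∸ i)) (suc k)
reverse-path {G} {c} {f} {k} path .edges i (s≤s i<k) =
  adjCol-sym (subst (AdjCol G c (f (k ∸ suc i)) ∘ f) eq (path .edges (k ∸ suc i) (s≤s (subst (_≤ k) (sym eq) (m∸n≤m k i)))))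
  where
  eq : suc (k ∸ suc i) ≡ k ∸ i
  eq = sym (+-∸-assoc 1 i<k)
reverse-path {k = k} path .distinct i j i<j (s≤s j≤k) eq =
  path .distinct (k ∸ j) (k ∸ i) (∸-monoʳ-< i<j j≤k) (s≤s (m∸n≤m k i)) (sym eq)
reverse-path {k = k} path .induced i j i<j (s≤s j≤k) adj =
  sym (∸-cancelˡ-≡ i<k j≤k (suc-injective (trans (sym (+-∸-assoc 1 i<k))
    (path .induced (k ∸ j) (k ∸ i) (∸-monoʳ-< i<j j≤k) (s≤s (m∸n≤m k i)) (adj-sym adj)))))
  where
  i<k : i < k
  i<k = ≤-trans i<j j≤k

-- A long monochromatic induced path

-- What is needed to put `x` in front of a path listed newest vertex first. An empty list imposes
-- nothing, so any vertex can begin a path.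
Attached : ColGraph → Colour → ℕ → List ℕ → Set
Attached G c x []       = ⊤
Attached G c x (y ∷ ys) = AdjCol G c x y × (∀ {z} → z ∈ ys → ¬ Adj G x z)

data Trail (G : ColGraph) (c : Colour) : List ℕ → Set where
  []  : Trail G c []
  add : ∀ {x xs} → x ∉ xs → Attached G c x xs → Trail G c xs → Trail G c (x ∷ xs)

nth : List ℕ → ℕ → ℕ
nth []       = λ _ → 0
nth (x ∷ xs) = cons x (nth xs)

nth-∈ : ∀ xs i → i < length xs → nth xs i ∈ xs
nth-∈ (x ∷ xs) zero    _         = here refl
nth-∈ (x ∷ xs) (suc i) (s≤s i<m) = there (nth-∈ xs i i<m)

trail-path : ∀ {G c xs} → Trail G c xs → InducedPath G c (nth xs) (length xs)
trail-path [] = record { edges = λ _ () ; distinct = λ _ _ _ () ; induced = λ _ _ _ () }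
trail-path {G} {c} (add {x} {xs} x∉xs att t) = cons-path (trail-path t) (start xs att)
  (λ i i<m eq → x∉xs (subst (_∈ xs) (sym eq) (nth-∈ xs i i<m))) (only xs att)
  where
  start : ∀ xs → Attached G c x xs → 0 < length xs → AdjCol G c x (nth xs 0)
  start (y ∷ ys) (col , _) _ = col

  only : ∀ xs → Attached G c x xs → ∀ i → i < length xs → Adj G x (nth xs i) → i ≡ 0
  only (y ∷ ys) _            zero    _         _   = refl
  only (y ∷ ys) (_ , nonadj) (suc i) (s≤s i<m) adj = contradiction adj (nonadj (nth-∈ ys i i<m))

Extends : ColGraph → ColGraph → Set
Extends G G′ = ∀ {c u w} → AdjCol G c u w → AdjCol G′ c u w

attached-frame : ∀ {G G′ c x xs} → Extends G G′ →
  (∀ {z} → z ∈ xs → Adj G′ x z → Adj G x z) → Attached G c x xs → Attached G′ c x xs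
attached-frame {xs = []}     keep frame _              = tt
attached-frame {xs = y ∷ ys} keep frame (col , nonadj) = keep col , λ z∈ys → nonadj z∈ys ∘ frame (there z∈ys)

trail-frame : ∀ {G G′ c xs} → Extends G G′ →
  (∀ {u w} → u ∈ xs → Adj G′ u w → Adj G u w) → Trail G c xs → Trail G′ c xs
trail-frame keep frame []               = []
trail-frame keep frame (add x∉xs att t) =
  add x∉xs (attached-frame keep (λ _ → frame (here refl)) att) (trail-frame keep (frame ∘ there) t)

-- A monochromatic induced path, newest vertex first, each vertex with its ports.
Stack : Set
Stack = List (ℕ × List ℕ)

verts : Stack → List ℕ
verts = map proj₁

names : Stack → List ℕ
names []             = []
names ((v , qs) ∷ S) = v ∷ qs ++ names S

ports : Stack → ℕ
ports []             = 0
ports ((v , qs) ∷ S) = length qs + ports S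

verts⊆names : ∀ {u} S → u ∈ verts S → u ∈ names S
verts⊆names ((v , qs) ∷ S) (here eq)  = here eq
verts⊆names ((v , qs) ∷ S) (there u∈) = there (∈-++⁺ʳ qs (verts⊆names S u∈))

-- Having no other neighbour is what allows a port to become the next vertex of the induced path.
Leaf : ColGraph → Colour → ℕ → ℕ → Set
Leaf G c v q = AdjCol G c q v × (∀ {w} → Adj G q w → w ≡ v)

HasLeaves : ColGraph → Colour → Stack → Set
HasLeaves G c = All λ (v , qs) → All (Leaf G c v) qs

leaves-frame : ∀ {G G′ c} S → Extends G G′ →
  (∀ {u w} → u ∈ names S → Adj G′ u w → Adj G u w) → HasLeaves G c S → HasLeaves G′ c S
leaves-frame []             keep frame []       = []
leaves-frame ((v , qs) ∷ S) keep frame (l ∷ ls) =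
  All.tabulate (λ q∈qs → let col , only = All.lookup l q∈qs in
    keep col , only ∘ frame (there (∈-++⁺ˡ q∈qs)))
  ∷ leaves-frame S keep (frame ∘ there ∘ ∈-++⁺ʳ qs) ls

record Chain (G : ColGraph) (c : Colour) (S : Stack) : Set where
  constructor chain
  field
    trail  : Trail G c (verts S)
    leaves : HasLeaves G c S
    unique : Unique (names S)

chain-frame : ∀ {G G′ c} S → Extends G G′ →
  (∀ {u w} → u ∈ names S → Adj G′ u w → Adj G u w) → Chain G c S → Chain G′ c S
chain-frame S keep frame (chain t l u) =
  chain (trail-frame keep (frame ∘ verts⊆names S) t) (leaves-frame S keep frame l) u

unique-∷ : ∀ {x : ℕ} {xs} → x ∉ xs → Unique xs → Unique (x ∷ xs)
unique-∷ x∉xs u = All.tabulate (λ z∈xs x≡z → x∉xs (subst (_∈ _) (sym x≡z) z∈xs)) ∷ u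

Low : ℕ × List ℕ → Set
Low (_ , qs) = length qs ≤ 3

-- Four ports are tolerated on the newest entry only: once a port is taken from it, or it is
-- discarded for having none, all entries are `Low`.
data Capped : Stack → Set where
  []  : Capped []
  _∷_ : ∀ {v qs S} → length qs ≤ 4 → All Low S → Capped ((v , qs) ∷ S)

low⇒capped : ∀ {S} → All Low S → Capped S
low⇒capped []       = []
low⇒capped (l ∷ ls) = ≤-trans l (n≤1+n 3) ∷ ls

low-ports : ∀ {S} → All Low S → ports S ≤ 3 * length (verts S)
low-ports []                          = z≤n
low-ports {(v , qs) ∷ S} (l ∷ ls)     = ≤-trans (+-mono-≤ l (low-ports ls))
  (≤-reflexive (sym (*-suc 3 (length (verts S)))))

capped-ports : ∀ {S} → Capped S → ports S ≤ suc (3 * length (verts S))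
capped-ports []                    = z≤n
capped-ports {(v , qs) ∷ S} (l ∷ ls) = ≤-trans (+-mono-≤ l (low-ports ls))
  (≤-reflexive (cong suc (sym (*-suc 3 (length (verts S))))))

-- A possible next vertex after the path in `S`. By `nbrs` an edge between the candidates of two
-- disjoint stacks is new, and neither candidate is adjacent to the other path.
record Candidate (G : ColGraph) (c : Colour) (S : Stack) (x : ℕ) : Set where
  field
    base     : Chain G c S
    attached : Attached G c x (verts S)
    fresh    : x ∉ names S
    nbrs     : ∀ {w} → Adj G x w → w ∈ verts S

-- Entries without ports are popped until a port is found; if there is none, the path restarts at
-- the fresh vertex `f`. Popped entries hold no ports, so at most one port is lost.
pick : ∀ {G c} S f → Capped S → Chain G c S → f ∉ names S → (∀ {w} → ¬ Adj G f w) →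
  ∃₂ λ x S′ → Candidate G c S′ x × (∀ {u} → u ∈ names S′ → u ∈ names S) ×
    (x ∈ names S ⊎ x ≡ f) × All Low S′ × ports S ≤ suc (ports S′)
pick [] f _ ch f∉ free = f , [] ,
  record { base = ch ; attached = tt ; fresh = f∉ ; nbrs = λ adj → contradiction adj free } ,
  id , inj₂ refl , [] , z≤n
pick ((v , []) ∷ S) f (_ ∷ low) (chain (add _ _ t) (_ ∷ ls) (_ ∷ u)) f∉ free =
  let x , S′ , cand , sub , origin , low′ , count = pick S f (low⇒capped low) (chain t ls u) (f∉ ∘ there) free
  in x , S′ , cand , there ∘ sub , Sum.map₁ there origin , low′ , count
pick {G} ((v , q ∷ qs) ∷ S) f (s≤s l ∷ low) (chain t ((( col , only) ∷ l′) ∷ ls) (v≢ ∷ q≢ ∷ u)) f∉ free =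
  q , (v , qs) ∷ S ,
  record { base = chain t (l′ ∷ ls) (unique-∷ (λ v∈ → All.lookup v≢ (there v∈) refl) u)
         ; attached = col , λ z∈ adj → All.lookup v≢ (there (∈-++⁺ʳ qs (verts⊆names S (subst (_∈ _) (only adj) z∈)))) refl
         ; fresh = λ { (here refl) → All.lookup v≢ (here refl) refl ; (there q∈) → All.lookup q≢ q∈ refl }
         ; nbrs = λ adj → here (only adj) } ,
  (λ { (here eq) → here eq ; (there u∈) → there (there u∈) }) , inj₁ (there (here refl)) , l ∷ low , ≤-refl

-- Adding leaves at a vertex

Bounded : ColGraph → ℕ → Set
Bounded G N = ∀ {u w} → Adj G u w → u < N

record Spread (G : ColGraph) (N y : ℕ) (G′ : ColGraph) (N′ : ℕ) : Set where
  field
    grow     : N ≤ N′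
    keep     : Extends G G′
    new      : ∀ {u w} → Adj G′ u w → Adj G u w ⊎ (u ≡ y × N ≤ w) ⊎ (w ≡ y × N ≤ u)
    bounded  : Bounded G′ N′
    loopless : Loopless G′

spread-step : ∀ {G N y G′ N′} k → y < N → Spread G N y G′ N′ → Spread G N y (edge y N′ k ∷ G′) (suc N′)
spread-step {G} {N} {y} {G′} {N′} k y<N sp = record
  { grow = m≤n⇒m≤1+n grow ; keep = there ∘ keep
  ; new = λ { (here (inj₁ (refl , refl))) → inj₂ (inj₁ (refl , grow))
            ; (here (inj₂ (refl , refl))) → inj₂ (inj₂ (refl , grow))
            ; (there adj) → new adj }
  ; bounded = λ { (here (inj₁ (refl , refl))) → m<n⇒m<1+n y<N′
                ; (here (inj₂ (refl , refl))) → n<1+n N′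
                ; (there adj) → m<n⇒m<1+n (bounded adj) }
  ; loopless = λ { (here (inj₁ (refl , refl))) → <-irrefl refl y<N′
                 ; (here (inj₂ (refl , refl))) → <-irrefl refl y<N′
                 ; (there adj) → loopless adj } }
  where
  open Spread sp
  y<N′ : y < N′
  y<N′ = <-≤-trans y<N grow

record Leaves (G : ColGraph) (N N′ : ℕ) (c : Colour) (y : ℕ) (zs : List ℕ) : Set where
  field
    unique : Unique zs
    above  : ∀ {z} → z ∈ zs → N ≤ z
    below  : ∀ {z} → z ∈ zs → z < N′
    leaf   : ∀ {z} → z ∈ zs → Leaf G c y z

leaves-keep : ∀ {N y G′ N′ c zs} k → y < N → Leaves G′ N N′ c y zs →
  Leaves (edge y N′ k ∷ G′) N (suc N′) c y zs
leaves-keep k y<N ls = record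
  { unique = unique ; above = above ; below = m<n⇒m<1+n ∘ below
  ; leaf = λ z∈ → there (proj₁ (leaf z∈)) ,
      λ { (here (inj₁ (refl , _))) → contradiction (<-≤-trans y<N (above z∈)) (<-irrefl refl)
        ; (here (inj₂ (_ , refl))) → contradiction (below z∈) (<-irrefl refl)
        ; (there adj) → proj₂ (leaf z∈) adj } }
  where open Leaves ls

leaves-add : ∀ {G N y G′ N′ c zs} → y < N → Spread G N y G′ N′ → Leaves G′ N N′ c y zs →
  Leaves (edge y N′ c ∷ G′) N (suc N′) c y (N′ ∷ zs)
leaves-add {N = N} {y} {G′} {N′} {c} {zs} y<N sp ls = record
  { unique = unique-∷ (λ N′∈ → <-irrefl refl (below N′∈)) unique
  ; above = λ { (here refl) → Spread.grow sp ; (there z∈) → above z∈ }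
  ; below = λ { (here refl) → n<1+n N′ ; (there z∈) → m<n⇒m<1+n (below z∈) }
  ; leaf = λ { (here refl) → here (refl , inj₂ (refl , refl)) ,
                 λ { (here (inj₁ (refl , _))) → contradiction (<-≤-trans y<N (Spread.grow sp)) (<-irrefl refl)
                   ; (here (inj₂ (refl , _))) → refl
                   ; (there adj) → contradiction (Spread.bounded sp adj) (<-irrefl refl) }
             ; (there z∈) → Leaves.leaf (leaves-keep c y<N ls) z∈ } }
  where open Leaves ls

no-leaves : ∀ {G N N′ c y} → Leaves G N N′ c y []
no-leaves = record { unique = [] ; above = λ () ; below = λ () ; leaf = λ () }

-- `suc a` and `suc b` leaves are still missing in the two colours. Each new edge lowers one of
-- these numbers, so by the pigeonhole principle one colour is complete within `a + b + 1` rounds.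
emit : ∀ {n m G N y c c′} → (∀ k → k ≡ c ⊎ k ≡ c′) → y < N →
  (∀ {G′ N′ zs} → Spread G N y G′ N′ → Leaves G′ N N′ c y zs → length zs ≡ 4 → BuilderWins n m G′) →
  (∀ {G′ N′ zs} → Spread G N y G′ N′ → Leaves G′ N N′ c′ y zs → length zs ≡ 4 → BuilderWins n m G′) →
  ∀ a b {G′ N′ zs zs′} → Spread G N y G′ N′ →
  Leaves G′ N N′ c y zs → length zs + suc a ≡ 4 →
  Leaves G′ N N′ c′ y zs′ → length zs′ + suc b ≡ 4 →
  BuilderWins n (suc (a + b) + m) G′
emit {n} {m} {G} {N} {y} {c} {c′} two y<N win win′ a b {G′} {N′} {zs} {zs′} sp ls eq ls′ eq′ =
  step y N′ (λ { refl → <-irrefl refl y<N′ }) (λ adj → <-irrefl refl (bounded (adj-sym adj)))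
    λ k → reply a b k (two k) eq eq′
  where
  open Spread sp
  y<N′ : y < N′
  y<N′ = <-≤-trans y<N grow

  reply : ∀ a b k → k ≡ c ⊎ k ≡ c′ → length zs + suc a ≡ 4 → length zs′ + suc b ≡ 4 →
    BuilderWins n (a + b + m) (edge y N′ k ∷ G′)
  reply zero b k (inj₁ refl) eq _ = weaken (m≤n+m m b)
    (win (spread-step k y<N sp) (leaves-add y<N sp ls) (trans (+-comm 1 (length zs)) eq))
  reply (suc a) b k (inj₁ refl) eq eq′ = emit two y<N win win′ a b (spread-step k y<N sp)
    (leaves-add y<N sp ls) (trans (sym (+-suc (length zs) (suc a))) eq)
    (leaves-keep k y<N ls′) eq′
  reply a zero k (inj₂ refl) _ eq′ = weaken (m≤n+m m (a + 0))
    (win′ (spread-step k y<N sp) (leaves-add y<N sp ls′) (trans (+-comm 1 (length zs′)) eq′))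
  reply a (suc b) k (inj₂ refl) eq eq′ = subst (λ e → BuilderWins n (e + m) (edge y N′ k ∷ G′)) (sym (+-suc a b))
    (emit two y<N win win′ a b (spread-step k y<N sp) (leaves-keep k y<N ls) eq
      (leaves-add y<N sp ls′) (trans (sym (+-suc (length zs′) (suc b))) eq′))

-- Exchanges between the two paths

record Position (G : ColGraph) (N : ℕ) (c : Colour) (S : Stack) (c′ : Colour) (T : Stack) : Set where
  field
    chainˢ   : Chain G c S
    chainᵗ   : Chain G c′ T
    apart    : ∀ {u} → u ∈ names S → u ∉ names T
    belowˢ   : ∀ {u} → u ∈ names S → u < N
    belowᵗ   : ∀ {u} → u ∈ names T → u < N
    cappedˢ  : Capped S
    cappedᵗ  : Capped T
    bounded  : Bounded G N
    loopless : Loopless G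

position-swap : ∀ {G N c S c′ T} → Position G N c S c′ T → Position G N c′ T c S
position-swap p = record
  { chainˢ = chainᵗ ; chainᵗ = chainˢ ; apart = λ u∈ v∈ → apart v∈ u∈ ; belowˢ = belowᵗ ; belowᵗ = belowˢ
  ; cappedˢ = cappedᵗ ; cappedᵗ = cappedˢ ; bounded = bounded ; loopless = loopless }
  where open Position p

record Duel (G : ColGraph) (N : ℕ) (c : Colour) (S : Stack) (x : ℕ) (c′ : Colour) (T : Stack) (y : ℕ) : Set where
  field
    candˢ    : Candidate G c S x
    candᵗ    : Candidate G c′ T y
    apart    : ∀ {u} → u ∈ x ∷ names S → u ∉ y ∷ names T
    belowˢ   : ∀ {u} → u ∈ x ∷ names S → u < N
    belowᵗ   : ∀ {u} → u ∈ y ∷ names T → u < N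
    lowˢ     : All Low S
    lowᵗ     : All Low T
    bounded  : Bounded G N
    loopless : Loopless G

duel-swap : ∀ {G N c S x c′ T y} → Duel G N c S x c′ T y → Duel G N c′ T y c S x
duel-swap d = record
  { candˢ = candᵗ ; candᵗ = candˢ ; apart = λ u∈ v∈ → apart v∈ u∈ ; belowˢ = belowᵗ ; belowᵗ = belowˢ
  ; lowˢ = lowᵗ ; lowᵗ = lowˢ ; bounded = bounded ; loopless = loopless }
  where open Duel d

-- Indifferent to the order of the endpoints, so that Painter's two answers become one case up to
-- exchanging the paths.
record Linked (G : ColGraph) (c : Colour) (x y : ℕ) (G′ : ColGraph) : Set where
  field
    link : AdjCol G′ c x y
    keep : Extends G G′
    new  : ∀ {u w} → Adj G′ u w → Adj G u w ⊎ (u ≡ x × w ≡ y) ⊎ (u ≡ y × w ≡ x)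

linked-edge : ∀ {G c x y} → Linked G c x y (edge x y c ∷ G)
linked-edge = record
  { link = here (refl , inj₁ (refl , refl)) ; keep = there
  ; new = λ { (here (inj₁ (refl , refl))) → inj₂ (inj₁ (refl , refl))
            ; (here (inj₂ (refl , refl))) → inj₂ (inj₂ (refl , refl))
            ; (there adj) → inj₁ adj } }

linked-swap : ∀ {G c x y G′} → Linked G c x y G′ → Linked G c y x G′
linked-swap l = record { link = adjCol-sym link ; keep = keep ; new = Sum.map₂ Sum.swap ∘ new }
  where open Linked l

Next : ℕ → ℕ → Colour → Colour → ℕ → Set
Next n m c c′ p = ∀ {G N S T} → Position G N c S c′ T → p ≤ ports S + ports T → BuilderWins n m G

module Attach {G N c S x c′ T y G₁} (d : Duel G N c S x c′ T y) (l : Linked G c x y G₁) where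
  open Duel d
  open Candidate

  x≢y : x ≢ y
  x≢y eq = apart (here refl) (here eq)

  x<N : x < N
  x<N = belowˢ (here refl)

  y<N : y < N
  y<N = belowᵗ (here refl)

  start : Spread G₁ N y G₁ N
  start = record
    { grow = ≤-refl ; keep = id ; new = inj₁
    ; bounded = λ adj → Sum.[ bounded , Sum.[ (λ (u≡x , _) → subst (_< N) (sym u≡x) x<N)
                                            , (λ (u≡y , _) → subst (_< N) (sym u≡y) y<N) ] ] (Linked.new l adj)
    ; loopless = λ adj → Sum.[ loopless , Sum.[ (λ (u≡x , u≡y) → x≢y (trans (sym u≡x) u≡y))
                                              , (λ (u≡y , u≡x) → x≢y (trans (sym u≡x) u≡y)) ] ] (Linked.new l adj) }

  module After {G′ N′} (sp : Spread G₁ N y G′ N′) where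
    open Spread sp using (grow; new)

    keep : Extends G G′
    keep = Spread.keep sp ∘ Linked.keep l

    -- Every edge added since `G` joins `y` to `x` or to a vertex from `N` on, so all other old
    -- vertices keep their neighbourhoods.
    frame : ∀ {u w} → u < N → u ≢ x → u ≢ y → Adj G′ u w → Adj G u w
    frame u<N u≢x u≢y adj with new adj
    ... | inj₂ (inj₁ (u≡y , _)) = contradiction u≡y u≢y
    ... | inj₂ (inj₂ (_ , N≤u)) = contradiction (<-≤-trans u<N N≤u) (<-irrefl refl)
    ... | inj₁ adj₁ with Linked.new l adj₁
    ...   | inj₁ adj₀             = adj₀
    ...   | inj₂ (inj₁ (u≡x , _)) = contradiction u≡x u≢x
    ...   | inj₂ (inj₂ (u≡y , _)) = contradiction u≡y u≢y

    frameˢ : ∀ {u w} → u ∈ names S → Adj G′ u w → Adj G u w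
    frameˢ u∈ = frame (belowˢ (there u∈)) (λ { refl → candˢ .fresh u∈ }) (λ { refl → apart (there u∈) (here refl) })

    frameᵗ : ∀ {u w} → u ∈ names T → Adj G′ u w → Adj G u w
    frameᵗ u∈ = frame (belowᵗ (there u∈)) (λ { refl → apart (here refl) (there u∈) }) (λ { refl → candᵗ .fresh u∈ })

    baseˢ : Chain G′ c S
    baseˢ = chain-frame S keep frameˢ (candˢ .base)

    baseᵗ : Chain G′ c′ T
    baseᵗ = chain-frame T keep frameᵗ (candᵗ .base)

    below′ : ∀ {u} → u < N → u < N′
    below′ u<N = <-≤-trans u<N grow

    nonadj-y : ∀ {z} → z ∈ names S → ¬ Adj G′ y z
    nonadj-y z∈ adj = apart (there z∈) (there (verts⊆names T (candᵗ .nbrs (adj-sym (frameˢ z∈ (adj-sym adj))))))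

    far : ∀ {u} {L : List ℕ} → (∀ {z} → z ∈ L → N ≤ z) → u < N → u ∉ L
    far above u<N u∈ = <-irrefl refl (<-≤-trans u<N (above u∈))

    -- The path in `c` grows by `x`, left without ports, and then by `y` with its four leaves.
    extend : ∀ {zs} → Leaves G′ N N′ c y zs → length zs ≡ 4 →
      Position G′ N′ c ((y , zs) ∷ (x , []) ∷ S) c′ T
    extend {zs} ls four = record
      { chainˢ = chain
          (add (λ { (here y≡x) → x≢y (sym y≡x)
                  ; (there y∈) → apart (there (verts⊆names S y∈)) (here refl) })
               (Spread.keep sp (adjCol-sym (Linked.link l)) , nonadj-y ∘ verts⊆names S)
               (add (candˢ .fresh ∘ verts⊆names S)
                    (attached-frame keep (λ z∈ adj → adj-sym (frameˢ (verts⊆names S z∈) (adj-sym adj)))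
                      (candˢ .attached))
                    (Chain.trail baseˢ)))
          (All.tabulate leaf ∷ [] ∷ Chain.leaves baseˢ)
          (unique-∷ y∉ (Unique.++⁺ unique (unique-∷ (candˢ .fresh) (Chain.unique baseˢ))
            λ (z∈ , u∈) → far above (belowˢ u∈) z∈))
      ; chainᵗ = baseᵗ
      ; apart = λ { (here refl) → candᵗ .fresh
                  ; (there u∈) v∈ → Sum.[ far above (belowᵗ (there v∈)) , (λ w∈ → apart w∈ (there v∈)) ] (∈-++⁻ zs u∈) }
      ; belowˢ = λ { (here refl) → below′ y<N
                   ; (there u∈) → Sum.[ below , below′ ∘ belowˢ ] (∈-++⁻ zs u∈) }
      ; belowᵗ = below′ ∘ belowᵗ ∘ there
      ; cappedˢ = ≤-reflexive four ∷ z≤n ∷ lowˢ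
      ; cappedᵗ = low⇒capped lowᵗ
      ; bounded = Spread.bounded sp
      ; loopless = Spread.loopless sp }
      where
      open Leaves ls
      y∉ : y ∉ zs ++ x ∷ names S
      y∉ y∈ = Sum.[ far above y<N , (λ w∈ → apart w∈ (here refl)) ] (∈-++⁻ zs y∈)

    -- The path in `c′` grows by `y` alone; `x` is abandoned and belongs to neither stack any more.
    extend′ : ∀ {zs} → Leaves G′ N N′ c′ y zs → length zs ≡ 4 →
      Position G′ N′ c S c′ ((y , zs) ∷ T)
    extend′ {zs} ls four = record
      { chainˢ = baseˢ
      ; chainᵗ = chain
          (add (candᵗ .fresh ∘ verts⊆names T)
               (attached-frame keep (λ z∈ adj → adj-sym (frameᵗ (verts⊆names T z∈) (adj-sym adj))) (candᵗ .attached))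
               (Chain.trail baseᵗ))
          (All.tabulate leaf ∷ Chain.leaves baseᵗ)
          (unique-∷ (λ y∈ → Sum.[ far above y<N , candᵗ .fresh ] (∈-++⁻ zs y∈))
            (Unique.++⁺ unique (Chain.unique baseᵗ) λ (z∈ , u∈) → far above (belowᵗ (there u∈)) z∈))
      ; apart = λ { v∈ (here refl) → apart (there v∈) (here refl)
                  ; v∈ (there u∈) → Sum.[ far above (belowˢ (there v∈)) , (λ w∈ → apart (there v∈) (there w∈)) ] (∈-++⁻ zs u∈) }
      ; belowˢ = below′ ∘ belowˢ ∘ there
      ; belowᵗ = λ { (here refl) → below′ y<N
                   ; (there u∈) → Sum.[ below , below′ ∘ belowᵗ ∘ there ] (∈-++⁻ zs u∈) }
      ; cappedˢ = low⇒capped lowˢ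
      ; cappedᵗ = ≤-reflexive four ∷ lowᵗ
      ; bounded = Spread.bounded sp
      ; loopless = Spread.loopless sp }
      where open Leaves ls

attach : ∀ {n m G N c S x c′ T y G₁} → (∀ k → k ≡ c ⊎ k ≡ c′) →
  Duel G N c S x c′ T y → Linked G c x y G₁ →
  Next n m c c′ (4 + (ports S + ports T)) → BuilderWins n (7 + m) G₁
attach {S = S} {T = T} two d l next = emit two y<N
  (λ sp ls four → next (After.extend sp ls four) (≤-reflexive (cong (λ e → e + ports S + ports T) (sym four))))
  (λ {_} {_} {zs} sp ls four → next (After.extend′ sp ls four) (≤-reflexive (begin
    4 + (ports S + ports T)         ≡⟨ cong (_+ (ports S + ports T)) (sym four) ⟩
    length zs + (ports S + ports T) ≡⟨ sym (+-assoc (length zs) (ports S) (ports T)) ⟩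
    length zs + ports S + ports T   ≡⟨ cong (_+ ports T) (+-comm (length zs) (ports S)) ⟩
    ports S + length zs + ports T   ≡⟨ +-assoc (ports S) (length zs) (ports T) ⟩
    ports S + (length zs + ports T) ∎)))
  -- At first four leaves are missing in each colour, which gives `3 + 3 + 1 = 7` rounds.
  3 3 start no-leaves refl no-leaves refl
  where
  open Attach d l
  open ≡-Reasoning

duel : ∀ {n m G N c S x c′ T y} → (∀ k → k ≡ c ⊎ k ≡ c′) → Duel G N c S x c′ T y →
  Next n m c c′ (4 + (ports S + ports T)) → BuilderWins n (8 + m) G
duel {G = G} {S = S} {x} {T = T} {y} two d next = step x y
  (λ x≡y → apart (here refl) (here x≡y))
  (λ adj → apart (there (verts⊆names S (Candidate.nbrs candˢ adj))) (here refl))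
  λ k → reply k (two k)
  where
  open Duel d
  reply : ∀ k → k ≡ _ ⊎ k ≡ _ → BuilderWins _ _ (edge x y k ∷ G)
  reply k (inj₁ refl) = attach two d linked-edge next
  reply k (inj₂ refl) = attach (Sum.swap ∘ two) (duel-swap d) (linked-swap linked-edge)
    λ {_} {_} {S′} {T′} p le → next (position-swap p)
      (subst₂ (λ a b → 4 + a ≤ b) (+-comm (ports T) (ports S)) (+-comm (ports S′) (ports T′)) le)

-- Four ports are gained and at most one is lost on each side, a net gain of two. `N` and `suc N`
-- are reserved as fresh vertices for stacks without ports, which raises the bound on names to
-- `2 + N`.
advance : ∀ {n m G N c S c′ T} → (∀ k → k ≡ c ⊎ k ≡ c′) → Position G N c S c′ T →
  Next n m c c′ (2 + (ports S + ports T)) → BuilderWins n (8 + m) G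
advance {G = G} {N} {c} {S} {c′} {T} two p next
  with pick S N (Position.cappedˢ p) (Position.chainˢ p)
         (λ N∈ → <-irrefl refl (Position.belowˢ p N∈)) (λ adj → <-irrefl refl (Position.bounded p adj))
     | pick T (suc N) (Position.cappedᵗ p) (Position.chainᵗ p)
         (λ N∈ → 1+n≰n (<⇒≤ (Position.belowᵗ p N∈))) (λ adj → 1+n≰n (<⇒≤ (Position.bounded p adj)))
... | x , S′ , cand , sub , origin , low , count | y , T′ , cand′ , sub′ , origin′ , low′ , count′ =
  duel two (record
    { candˢ = cand ; candᵗ = cand′ ; apart = apart′
    ; belowˢ = λ { (here refl) → low-x origin ; (there u∈) → raise (belowˢ (sub u∈)) }
    ; belowᵗ = λ { (here refl) → low-y origin′ ; (there u∈) → raise (belowᵗ (sub′ u∈)) }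
    ; lowˢ = low ; lowᵗ = low′ ; bounded = raise ∘ bounded ; loopless = loopless })
  λ q le → next q (≤-trans (s≤s (s≤s (≤-trans (+-mono-≤ count count′)
    (≤-reflexive (cong suc (+-suc (ports S′) (ports T′))))))) le)
  where
  open Position p
  raise : ∀ {u} → u < N → u < 2 + N
  raise u<N = m<n⇒m<1+n (m<n⇒m<1+n u<N)

  low-x : x ∈ names S ⊎ x ≡ N → x < 2 + N
  low-x (inj₁ x∈)   = raise (belowˢ x∈)
  low-x (inj₂ refl) = n≤1+n (suc N)

  low-y : y ∈ names T ⊎ y ≡ suc N → y < 2 + N
  low-y (inj₁ y∈)   = raise (belowᵗ y∈)
  low-y (inj₂ refl) = ≤-refl

  origins : ∀ {u} → u ∈ x ∷ names S′ → u ∈ names S ⊎ u ≡ N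
  origins (here refl) = origin
  origins (there u∈)  = inj₁ (sub u∈)

  origins′ : ∀ {u} → u ∈ y ∷ names T′ → u ∈ names T ⊎ u ≡ suc N
  origins′ (here refl) = origin′
  origins′ (there u∈)  = inj₁ (sub′ u∈)

  apart′ : ∀ {u} → u ∈ x ∷ names S′ → u ∉ y ∷ names T′
  apart′ u∈ v∈ with origins u∈ | origins′ v∈
  ... | inj₁ a    | inj₁ b    = apart a b
  ... | inj₁ a    | inj₂ refl = 1+n≰n (<⇒≤ (belowˢ a))
  ... | inj₂ refl | inj₁ b    = <-irrefl refl (belowᵗ b)
  ... | inj₂ refl | inj₂ eq   = 1+n≢n (sym eq)

play : ∀ {n m c c′ G N S T} → (∀ k → k ≡ c ⊎ k ≡ c′) → ∀ t → Position G N c S c′ T →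
  Next n m c c′ (t * 2 + (ports S + ports T)) → BuilderWins n (t * 8 + m) G
play two zero p next = next p ≤-refl
play {S = S} {T} two (suc t) p next =
  advance two p λ {_} {_} {S′} {T′} q le → play two t q λ r le′ → next r
    (≤-trans (≤-trans (≤-reflexive (shift (t * 2) (ports S + ports T))) (+-monoʳ-≤ (t * 2) le)) le′)
  where
  shift : ∀ a b → 2 + a + b ≡ a + (2 + b)
  shift a b = trans (cong (_+ b) (+-comm 2 a)) (+-assoc a 2 b)

-- After `3ℓ + 2` exchanges there are at least `2 (3ℓ + 2)` ports, whereas two paths of at most `ℓ`
-- vertices carry at most `2 (3ℓ + 1)`. Painter determines the colour of the long path, so `next`
-- has to accept either.
force-path : ∀ {n m} ℓ →
  (∀ {G N c c′ f} → (∀ k → k ≡ c ⊎ k ≡ c′) → InducedPath G c f (suc ℓ) → (∀ i → i < suc ℓ → f i < N) →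
    Bounded G N → Loopless G → BuilderWins n m G) →
  BuilderWins n ((3 * ℓ + 2) * 8 + m) []
force-path {n} {m} ℓ next = play two (3 * ℓ + 2) empty finish
  where
  two : ∀ k → k ≡ red ⊎ k ≡ blue
  two red  = inj₁ refl
  two blue = inj₂ refl

  empty : Position [] 0 red [] blue []
  empty = record
    { chainˢ = chain [] [] [] ; chainᵗ = chain [] [] [] ; apart = λ () ; belowˢ = λ () ; belowᵗ = λ ()
    ; cappedˢ = [] ; cappedᵗ = [] ; bounded = λ () ; loopless = λ () }

  use : ∀ {G N c S c′ T} → (∀ k → k ≡ c ⊎ k ≡ c′) → Position G N c S c′ T → suc ℓ ≤ length (verts S) →
    BuilderWins n m G
  use {S = S} two p long = next two
    (segment-path 0 (trail-path (Chain.trail chainˢ)) long)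
    (λ i i≤ℓ → belowˢ (verts⊆names S (nth-∈ (verts S) i (≤-trans i≤ℓ long)))) bounded loopless
    where open Position p

  finish : Next n m red blue ((3 * ℓ + 2) * 2 + 0)
  finish {S = S} {T} p le with suc ℓ ≤? length (verts S) | suc ℓ ≤? length (verts T)
  ... | yes long | _        = use two p long
  ... | no _     | yes long = use (Sum.swap ∘ two) (position-swap p) long
  ... | no short | no short′ = contradiction (≤-trans le (+-mono-≤
      (≤-trans (capped-ports (Position.cappedˢ p)) (s≤s (*-monoʳ-≤ 3 (s≤s⁻¹ (≰⇒> short)))))
      (≤-trans (capped-ports (Position.cappedᵗ p)) (s≤s (*-monoʳ-≤ 3 (s≤s⁻¹ (≰⇒> short′)))))))
    (<⇒≱ (subst (suc (3 * ℓ) + suc (3 * ℓ) <_) (total (3 * ℓ)) (m<m+n (suc (3 * ℓ) + suc (3 * ℓ)) {2} (s≤s z≤n))))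
    where
    total : ∀ a → suc a + suc a + 2 ≡ (a + 2) * 2 + 0
    total = solve-∀

-- Joining new vertices to the path

-- Uniqueness of quotient and remainder. It is used modulo `W` to tell segments apart and modulo `d`
-- to tell rows apart.
euclid : ∀ {m} a b {x y} → x < m → y < m → a * m + x ≡ b * m + y → a ≡ b × x ≡ y
euclid zero zero _ _ eq = refl , eq
euclid {m} zero (suc b) {y = y} x<m _ eq = contradiction x<m (≤⇒≯ (subst (m ≤_) (sym eq)
  (≤-trans (m≤m+n m (b * m)) (m≤m+n (m + b * m) y))))
euclid {m} (suc a) zero {x} _ y<m eq = contradiction y<m (≤⇒≯ (subst (m ≤_) eq
  (≤-trans (m≤m+n m (a * m)) (m≤m+n (m + a * m) x))))
euclid {m} (suc a) (suc b) {x} {y} x<m y<m eq =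
  let a≡b , x≡y = euclid a b x<m y<m (+-cancelˡ-≡ m _ _
        (trans (sym (+-assoc m (a * m) x)) (trans eq (+-assoc m (b * m) y))))
  in cong suc a≡b , x≡y

choice : ∀ {R : ℕ → ℕ → Set} k → (∀ j → j < k → ∃ (R j)) → ∃ λ (f : ℕ → ℕ) → ∀ j → j < k → R j (f j)
choice zero    _ = (λ _ → 0) , λ _ ()
choice {R} (suc k) g with f , r ← choice {R ∘ suc} k (λ j j<k → g (suc j) (s≤s j<k)) =
  cons (proj₁ (g 0 (s≤s z≤n))) f ,
  λ { zero _ → proj₂ (g 0 (s≤s z≤n)) ; (suc j) (s≤s j<k) → r j j<k }

-- Paths alternating between two sequences

braid : (ℕ → ℕ) → (ℕ → ℕ) → ℕ → ℕ
braid Y Q zero          = Y 0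
braid Y Q (suc zero)    = Q 0
braid Y Q (suc (suc i)) = braid (Y ∘ suc) (Q ∘ suc) i

braid-view : ∀ Y Q i → (∃ λ a → i ≡ a * 2 × braid Y Q i ≡ Y a) ⊎ (∃ λ a → i ≡ suc (a * 2) × braid Y Q i ≡ Q a)
braid-view Y Q zero          = inj₁ (0 , refl , refl)
braid-view Y Q (suc zero)    = inj₂ (0 , refl , refl)
braid-view Y Q (suc (suc i)) = Sum.map
  (λ (a , i≡ , eq) → suc a , cong (2 +_) i≡ , eq) (λ (a , i≡ , eq) → suc a , cong (2 +_) i≡ , eq)
  (braid-view (Y ∘ suc) (Q ∘ suc) i)

braid-even : ∀ Y Q a → braid Y Q (a * 2) ≡ Y a
braid-even Y Q zero    = refl
braid-even Y Q (suc a) = braid-even (Y ∘ suc) (Q ∘ suc) a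

m*2≢1+n*2 : ∀ a b → a * 2 ≢ suc (b * 2)
m*2≢1+n*2 (suc a) (suc b) eq = m*2≢1+n*2 a b (suc-injective (suc-injective eq))

half-< : ∀ {a k} → a * 2 < suc (k * 2) → a ≤ k
half-< {a} {k} lt = *-cancelʳ-≤ a k 2 (s≤s⁻¹ lt)

half-<′ : ∀ {a k} → suc (a * 2) < suc (k * 2) → a < k
half-<′ {a} {k} lt = *-cancelʳ-< 2 a k (s≤s⁻¹ lt)

-- The order is `Y 0`, `Q 0`, `Y 1`, up to `Y K`, with one `Y` more than `Q`, so that a final `Q K`
-- can close it to an even cycle.
braid-path : ∀ {G c} K Y Q →
  (∀ j → j < K → AdjCol G c (Y j) (Q j)) → (∀ j → j < K → AdjCol G c (Y (suc j)) (Q j)) →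
  (∀ i j → i ≤ K → j ≤ K → i ≢ j → Y i ≢ Y j × ¬ Adj G (Y i) (Y j)) →
  (∀ i j → i < K → j < K → i ≢ j → Q i ≢ Q j × ¬ Adj G (Q i) (Q j)) →
  (∀ i j → i ≤ K → j < K → Y i ≢ Q j × (Adj G (Y i) (Q j) → i ≡ j ⊎ i ≡ suc j)) →
  InducedPath G c (braid Y Q) (suc (K * 2))
braid-path {G} {c} K Y Q before after YY QQ YQ =
  record { edges = edges′ ; distinct = distinct′ ; induced = induced′ }
  where
  edges′ : ∀ i → suc i < suc (K * 2) → AdjCol G c (braid Y Q i) (braid Y Q (suc i))
  edges′ i lt with braid-view Y Q i | braid-view Y Q (suc i)
  ... | inj₁ (a , refl , _) | inj₁ (a′ , eq , _) = contradiction (sym eq) (m*2≢1+n*2 a′ a)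
  ... | inj₁ (a , refl , eq) | inj₂ (a′ , i≡ , eq′)
    with refl ← *-cancelʳ-≡ a a′ 2 (suc-injective i≡) = subst₂ (AdjCol G c) (sym eq) (sym eq′) (before a (half-<′ lt))
  ... | inj₂ (a , refl , eq) | inj₁ (a′ , i≡ , eq′)
    with refl ← *-cancelʳ-≡ (suc a) a′ 2 i≡ =
      subst₂ (AdjCol G c) (sym eq) (sym eq′) (adjCol-sym (after a (half-< {suc a} lt)))
  ... | inj₂ (a , refl , _) | inj₂ (a′ , eq , _) = contradiction (suc-injective (sym eq)) (λ e → m*2≢1+n*2 a′ a e)

  ≢-half : ∀ {a b} → a * 2 < b * 2 → a ≢ b
  ≢-half lt refl = <-irrefl refl lt

  distinct′ : ∀ i j → i < j → j < suc (K * 2) → braid Y Q i ≢ braid Y Q j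
  distinct′ i j i<j j<m with braid-view Y Q i | braid-view Y Q j
  ... | inj₁ (a , refl , eq) | inj₁ (b , refl , eq′) = subst₂ _≢_ (sym eq) (sym eq′)
    (proj₁ (YY a b (half-< (<-trans i<j j<m)) (half-< j<m) (≢-half i<j)))
  ... | inj₁ (a , refl , eq) | inj₂ (b , refl , eq′) = subst₂ _≢_ (sym eq) (sym eq′)
    (proj₁ (YQ a b (half-< (<-trans i<j j<m)) (half-<′ j<m)))
  ... | inj₂ (a , refl , eq) | inj₁ (b , refl , eq′) = subst₂ _≢_ (sym eq) (sym eq′)
    (proj₁ (YQ b a (half-< j<m) (half-<′ (<-trans i<j j<m))) ∘ sym)
  ... | inj₂ (a , refl , eq) | inj₂ (b , refl , eq′) = subst₂ _≢_ (sym eq) (sym eq′)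
    (proj₁ (QQ a b (half-<′ (<-trans i<j j<m)) (half-<′ j<m) (≢-half (s≤s⁻¹ i<j))))

  induced′ : ∀ i j → i < j → j < suc (K * 2) → Adj G (braid Y Q i) (braid Y Q j) → j ≡ suc i
  induced′ i j i<j j<m adj with braid-view Y Q i | braid-view Y Q j
  ... | inj₁ (a , refl , eq) | inj₁ (b , refl , eq′) = contradiction (subst₂ (Adj G) eq eq′ adj)
    (proj₂ (YY a b (half-< (<-trans i<j j<m)) (half-< j<m) (≢-half i<j)))
  ... | inj₁ (a , refl , eq) | inj₂ (b , refl , eq′)
    with proj₂ (YQ a b (half-< (<-trans i<j j<m)) (half-<′ j<m)) (subst₂ (Adj G) eq eq′ adj)
  ...   | inj₁ refl = refl
  ...   | inj₂ refl = contradiction (<-trans i<j (n<1+n _)) (<-irrefl refl)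
  induced′ i j i<j j<m adj | inj₂ (a , refl , eq) | inj₁ (b , refl , eq′)
    with proj₂ (YQ b a (half-< j<m) (half-<′ (<-trans i<j j<m))) (adj-sym (subst₂ (Adj G) eq eq′ adj))
  ...   | inj₁ refl = contradiction (<-trans i<j (n<1+n _)) (<-irrefl refl)
  ...   | inj₂ refl = refl
  induced′ i j i<j j<m adj | inj₂ (a , refl , eq) | inj₂ (b , refl , eq′) = contradiction (subst₂ (Adj G) eq eq′ adj)
    (proj₂ (QQ a b (half-<′ (<-trans i<j j<m)) (half-<′ j<m) (≢-half (s≤s⁻¹ i<j))))

-- The cyclic successor on the numbers from 0 to `K`.
nxt : ℕ → ℕ → ℕ
nxt K j with j ≟ K
... | yes _ = 0
... | no _  = suc j

nxt-last : ∀ K → nxt K K ≡ 0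
nxt-last K with K ≟ K
... | yes _ = refl
... | no ne = contradiction refl ne

nxt-suc : ∀ {K j} → j < K → nxt K j ≡ suc j
nxt-suc {K} {j} j<K with j ≟ K
... | yes refl = contradiction j<K (<-irrefl refl)
... | no _     = refl

nxt-≤ : ∀ {K j} → j ≤ K → nxt K j ≤ K
nxt-≤ {K} {j} j≤K with j ≟ K
... | yes _  = z≤n
... | no j≢K = ≤∧≢⇒< j≤K j≢K

nxt-injective : ∀ {K i j} → nxt K i ≡ nxt K j → i ≡ j
nxt-injective {K} {i} {j} eq with i ≟ K | j ≟ K | eq
... | yes refl | yes refl | _    = refl
... | no _     | no _     | refl = refl
... | yes _    | no _     | ()
... | no _     | yes _    | ()

-- The graph after a list of tests

Test : Set
Test = ℕ × ℕ × Colour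

-- A test (i , q , k) is an edge of colour k between the new vertex b + i and P q.
module Board {G₀ c c′ P L b} (h : ℕ) (two : ∀ k → k ≡ c ⊎ k ≡ c′) (path : InducedPath G₀ c P L)
  (below : ∀ q → q < L → P q < b) (bounded : Bounded G₀ b) (loopless : Loopless G₀) where

  d : ℕ
  d = 2 + h * 2

  board : List Test → ColGraph
  board []                 = G₀
  board ((i , q , k) ∷ ts) = edge (b + i) (P q) k ∷ board ts

  Inside : List Test → Set
  Inside ts = ∀ {i q k} → (i , q , k) ∈ ts → q < L

  board-col : ∀ {ts i q k} → (i , q , k) ∈ ts → AdjCol (board ts) k (b + i) (P q)
  board-col (here refl)                        = here (refl , inj₁ (refl , refl))
  board-col {ts = (_ , _ , _) ∷ _} (there t∈) = there (board-col t∈)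

  board-keep : ∀ ts → Extends G₀ (board ts)
  board-keep []                 = id
  board-keep ((_ , _ , _) ∷ ts) = there ∘ board-keep ts

  board-adj : ∀ ts {u w} → Adj (board ts) u w → Adj G₀ u w ⊎
    ∃ λ i → ∃₂ λ q k → (i , q , k) ∈ ts × ((u ≡ b + i × w ≡ P q) ⊎ (u ≡ P q × w ≡ b + i))
  board-adj [] adj = inj₁ adj
  board-adj ((i , q , k) ∷ ts) (here (inj₁ (refl , refl))) = inj₂ (i , q , k , here refl , inj₁ (refl , refl))
  board-adj ((i , q , k) ∷ ts) (here (inj₂ (refl , refl))) = inj₂ (i , q , k , here refl , inj₂ (refl , refl))
  board-adj ((i , q , k) ∷ ts) (there adj) =
    Sum.map₂ (λ (i′ , q′ , k′ , t∈ , eqs) → i′ , q′ , k′ , there t∈ , eqs) (board-adj ts adj)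

  extra≢path : ∀ {i q} → q < L → b + i ≢ P q
  extra≢path {i} q<L eq = <-irrefl (sym eq) (<-≤-trans (below _ q<L) (m≤m+n b i))

  P-injective : ∀ {q q′} → q < L → q′ < L → P q ≡ P q′ → q ≡ q′
  P-injective {q} {q′} q<L q′<L eq with <-cmp q q′
  ... | tri< q<q′ _ _ = contradiction eq (path .distinct q q′ q<q′ q′<L)
  ... | tri≈ _ q≡q′ _ = q≡q′
  ... | tri> _ _ q′<q = contradiction (sym eq) (path .distinct q′ q q′<q q<L)

  module _ {ts} (inside : Inside ts) where

    adj-path : ∀ {q q′} → q < L → q′ < L → Adj (board ts) (P q) (P q′) → Adj G₀ (P q) (P q′)
    adj-path q<L q′<L adj with board-adj ts adj
    ... | inj₁ adj₀                                   = adj₀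
    ... | inj₂ (_ , _ , _ , _ , inj₁ (eq , _)) = contradiction (sym eq) (extra≢path q<L)
    ... | inj₂ (_ , _ , _ , _ , inj₂ (_ , eq)) = contradiction (sym eq) (extra≢path q′<L)

    adj-extra-path : ∀ {i q} → q < L → Adj (board ts) (b + i) (P q) → ∃ λ k → (i , q , k) ∈ ts
    adj-extra-path {i} {q} q<L adj with board-adj ts adj
    ... | inj₁ adj₀ = contradiction (bounded adj₀) (m+n≮m b i)
    ... | inj₂ (i′ , q′ , k , t∈ , inj₂ (eq , _)) = contradiction eq (extra≢path (inside t∈))
    ... | inj₂ (i′ , q′ , k , t∈ , inj₁ (eq , eq′))
      with refl ← +-cancelˡ-≡ b _ _ eq | refl ← P-injective q<L (inside t∈) eq′ = k , t∈

    adj-extra : ∀ {i j} → ¬ Adj (board ts) (b + i) (b + j)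
    adj-extra {i} {j} adj with board-adj ts adj
    ... | inj₁ adj₀ = contradiction (bounded adj₀) (m+n≮m b i)
    ... | inj₂ (_ , _ , _ , t∈ , inj₁ (_ , eq)) = extra≢path (inside t∈) eq
    ... | inj₂ (_ , _ , _ , t∈ , inj₂ (eq , _)) = extra≢path (inside t∈) eq

    board-loopless : Loopless (board ts)
    board-loopless adj with board-adj ts adj
    ... | inj₁ adj₀ = loopless adj₀
    ... | inj₂ (_ , _ , _ , t∈ , inj₁ (eq , eq′)) = extra≢path (inside t∈) (trans (sym eq) eq′)
    ... | inj₂ (_ , _ , _ , t∈ , inj₂ (eq , eq′)) = extra≢path (inside t∈) (trans (sym eq′) eq)

    board-path : InducedPath (board ts) c P L
    board-path .edges i i<L = board-keep ts (path .edges i i<L)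
    board-path .distinct = path .distinct
    board-path .induced i j i<j j<L adj = path .induced i j i<j j<L (adj-path (<-trans i<j j<L) j<L adj)

    probe : ∀ {n m} i q → q < L → (∀ k → (i , q , k) ∉ ts) →
      (∀ k → BuilderWins n m (board ((i , q , k) ∷ ts))) → BuilderWins n (suc m) (board ts)
    probe i q q<L new = step (b + i) (P q) (extra≢path q<L)
      (λ adj → let k , t∈ = adj-extra-path q<L adj in new k t∈)

    -- The new vertex and the `d + 1` path vertices from `P q` to `P (q + d)` form a cycle on
    -- `d + 2 = n` vertices. Tests in between are excluded in either colour, since any edge would be
    -- a chord.
    arch : ∀ {i} q → (i , q , c) ∈ ts → (i , q + d , c) ∈ ts →
      (∀ t k → t ≤ d → (i , q + t , k) ∈ ts → t ≡ 0 ⊎ t ≡ d) →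
      MonoInducedCycle (4 + h * 2) (board ts)
    arch {i} q t∈ t∈′ chord = close-path (b + i) board-loopless
      (segment-path q board-path (subst (_≤ L) (sym (+-suc q d)) (inside t∈′)))
      (subst (AdjCol (board ts) c (b + i) ∘ P) (sym (+-identityʳ q)) (board-col t∈)) (board-col t∈′)
      (λ t t≤d → extra≢path (in-range t≤d))
      (λ t t≤d adj → let k , t∈ = adj-extra-path (in-range t≤d) adj in chord t k t≤d t∈)
      where
      in-range : ∀ {t} → t ≤ d → q + t < L
      in-range t≤d = ≤-<-trans (+-monoʳ-≤ q t≤d) (inside t∈′)

    -- The cycle runs from `P q` up to `P (q + h)`, through `b + j` to `P (q₂ + h)`, down to `P q₂`
    -- and back through `b + i`: `2 (h + 1) + 2` vertices. The gap keeps the two stretches of `P`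
    -- nonadjacent.
    bridge : ∀ {i j} q q₂ → i ≢ j → q + suc h < q₂ →
      (i , q , c) ∈ ts → (i , q₂ , c) ∈ ts → (j , q + h , c) ∈ ts → (j , q₂ + h , c) ∈ ts →
      (∀ t k → t ≤ h → (i , q + t , k) ∈ ts → t ≡ 0) → (∀ t k → t ≤ h → (i , q₂ + t , k) ∈ ts → t ≡ 0) →
      (∀ t k → t ≤ h → (j , q + t , k) ∈ ts → t ≡ h) → (∀ t k → t ≤ h → (j , q₂ + t , k) ∈ ts → t ≡ h) →
      MonoInducedCycle (4 + h * 2) (board ts)
    bridge {i} {j} q q₂ i≢j gap iq iq₂ jq jq₂ chord-i chord-i₂ chord-j chord-j₂ =
      subst (λ n → MonoInducedCycle n (board ts)) (size h)
        (close-path (b + i) board-loopless whole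
          (subst (AdjCol (board ts) c (b + i) ∘ P) (sym (+-identityʳ q)) (board-col iq))
          (subst (AdjCol (board ts) c (b + i)) last-vertex (board-col iq₂)) fresh only)
      where
      size : ∀ h → 2 + (h + suc (suc h)) ≡ 4 + h * 2
      size = solve-∀

      first second : ℕ → ℕ
      first t = P (q + t)
      second  = cons (b + j) (λ t → P (q₂ + (h ∸ t)))

      in-range₂ : ∀ {t} → t ≤ h → q₂ + t < L
      in-range₂ t≤h = ≤-<-trans (+-monoʳ-≤ q₂ t≤h) (inside jq₂)

      order : ∀ {t t′} → t ≤ h → suc (q + t) < q₂ + t′
      order {t} {t′} t≤h = ≤-trans (s≤s (subst (_≤ q + suc h) (+-suc q t) (+-monoʳ-≤ q (s≤s t≤h))))
        (≤-trans gap (m≤m+n q₂ t′))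

      in-range : ∀ {t} → t ≤ h → q + t < L
      in-range t≤h = <-trans (<-trans (n<1+n _) (order {t′ = 0} t≤h)) (in-range₂ z≤n)

      first-path : InducedPath (board ts) c first (suc h)
      first-path = segment-path q board-path (subst (_≤ L) (sym (+-suc q h)) (in-range ≤-refl))

      second-path : InducedPath (board ts) c second (suc (suc h))
      second-path = cons-path
        (reverse-path {k = h} (segment-path q₂ board-path (subst (_≤ L) (sym (+-suc q₂ h)) (in-range₂ ≤-refl))))
        (λ _ → board-col jq₂)
        (λ t t<h → extra≢path (in-range₂ (m∸n≤m h t)))
        (λ t t<h adj → let k , t∈ = adj-extra-path (in-range₂ (m∸n≤m h t)) adj in
          n≡0 t<h (chord-j₂ (h ∸ t) k (m∸n≤m h t) t∈))
        where
        n≡0 : ∀ {t} → t < suc h → h ∸ t ≡ h → t ≡ 0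
        n≡0 {t} (s≤s t≤h) eq = ∸-cancelˡ-≡ t≤h z≤n eq

      whole : InducedPath (board ts) c (append (suc h) first second) (suc h + suc (suc h))
      whole = append-path h first-path second-path
        (λ _ → adjCol-sym (board-col jq))
        (λ { t zero t≤h _ eq → extra≢path (in-range t≤h) (sym eq)
           ; t (suc t′) t≤h _ → path .distinct _ _ (<-trans (n<1+n _) (order t≤h)) (in-range₂ (m∸n≤m h t′)) })
        (λ { t zero t≤h _ adj → let k , t∈ = adj-extra-path (in-range t≤h) (adj-sym adj) in
               chord-j t k t≤h t∈ , refl
           ; t (suc t′) t≤h _ adj → contradiction
               (path .induced _ _ (<-trans (n<1+n _) (order t≤h)) (in-range₂ (m∸n≤m h t′))
                 (adj-path (in-range t≤h) (in-range₂ (m∸n≤m h t′)) adj))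
               (<⇒≢ (order t≤h) ∘ sym) })

      last-vertex : P q₂ ≡ append (suc h) first second (h + suc (suc h))
      last-vertex = sym (trans (cong (append (suc h) first second) (+-suc h (suc h)))
        (trans (append-right (suc h) first second (suc h)) (cong P (trans (cong (q₂ +_) (n∸n≡0 h)) (+-identityʳ q₂)))))

      fresh : ∀ t → t ≤ h + suc (suc h) → b + i ≢ append (suc h) first second t
      fresh t t≤m with split (suc h) t
      ... | inj₁ t<h = subst (b + i ≢_) (sym (append-left (suc h) first second t<h)) (extra≢path (in-range (s≤s⁻¹ t<h)))
      ... | inj₂ (zero , refl) = subst (b + i ≢_) (sym (append-right (suc h) first second 0)) (i≢j ∘ +-cancelˡ-≡ b _ _)
      ... | inj₂ (suc t′ , refl) = subst (b + i ≢_) (sym (append-right (suc h) first second (suc t′)))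
        (extra≢path (in-range₂ (m∸n≤m h t′)))

      only : ∀ t → t ≤ h + suc (suc h) → Adj (board ts) (b + i) (append (suc h) first second t) →
        t ≡ 0 ⊎ t ≡ h + suc (suc h)
      only t t≤m adj with split (suc h) t
      ... | inj₁ t<h =
        let k , t∈ = adj-extra-path (in-range (s≤s⁻¹ t<h)) (subst (Adj (board ts) (b + i)) (append-left (suc h) first second t<h) adj)
        in inj₁ (chord-i t k (s≤s⁻¹ t<h) t∈)
      ... | inj₂ (zero , refl) = contradiction (subst (Adj (board ts) (b + i)) (append-right (suc h) first second 0) adj) adj-extra
      -- On the reversed stretch `b + i` meets only offset 0, which is its last vertex.
      ... | inj₂ (suc t′ , refl) =
        let k , t∈ = adj-extra-path (in-range₂ (m∸n≤m h t′))
                       (subst (Adj (board ts) (b + i)) (append-right (suc h) first second (suc t′)) adj)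
            h≤t′ = m∸n≡0⇒m≤n (chord-i₂ (h ∸ t′) k (m∸n≤m h t′) t∈)
            t′≤h = s≤s⁻¹ (+-cancelˡ-≤ h (suc t′) (suc h) (s≤s⁻¹ (subst (suc (h + suc t′) ≤_) (+-suc h (suc h)) t≤m)))
        in inj₂ (trans (cong (λ e → suc h + suc e) (≤-antisym t′≤h h≤t′)) (sym (+-suc h (suc h))))

-- Links of the cycle

-- P is cut into segments of length W, and link j uses rows of the segment seg j that start
-- at offset 2 · slot j or at that offset shifted by h. Consecutive links need different
-- segments, since a vertex of the cycle is joined to the rows of both of its links.
record Layout (h W L : ℕ) : Set where
  field
    seg slot   : ℕ → ℕ
    fits       : ∀ {j} → j ≤ suc h → suc (slot j * 2 + (h + 3 * (2 + h * 2))) < W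
    inside     : ∀ {j} → j ≤ suc h → seg j * W + (slot j * 2 + (h + 3 * (2 + h * 2))) < L
    small      : ∀ {j} → j ≤ suc h → slot j ≡ 0 ⊎ 2 + slot j * 2 ≤ h
    determined : ∀ {i j} → i ≤ suc h → j ≤ suc h → seg i ≡ seg j → slot i ≡ slot j → i ≡ j
    alternate  : ∀ {j} → j ≤ suc h → seg (nxt (suc h) j) ≢ seg j

-- The premises are contradictory, since an offset below `h` cannot equal one shifted by `h`; the
-- conclusion has the form wanted in `slot-clash`.
slot-apart : ∀ {h s s′} → 2 + s * 2 ≤ h → s * 2 ≡ s′ * 2 + h → s ≡ s′
slot-apart {h} {s} {s′} le eq = contradiction (≤-trans (n≤1+n _) (≤-trans le (≤-trans (m≤n+m h (s′ * 2)) (≤-reflexive (sym eq))))) 1+n≰n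

slot-apart′ : ∀ {h s s′} → 2 + s * 2 ≤ h → suc (s * 2) ≡ s′ * 2 + h → s ≡ s′
slot-apart′ {h} {s} {s′} le eq = contradiction (≤-trans le (≤-trans (m≤n+m h (s′ * 2)) (≤-reflexive (sym eq)))) 1+n≰n

-- Slots start at even offsets, so under a common shift two of them never differ by exactly one.
slot-level : ∀ {s s′ δ} e → δ ≡ 0 ⊎ δ ≡ 1 → s * 2 + (e + δ) ≡ s′ * 2 + e → s ≡ s′
slot-level {s} {s′} e δ∈ eq = split-δ δ∈ (+-cancelʳ-≡ e _ _ (trans (shuffle (s * 2) _ e) eq))
  where
  shuffle : ∀ a x e → a + x + e ≡ a + (e + x)
  shuffle = solve-∀

  split-δ : ∀ {δ} → δ ≡ 0 ⊎ δ ≡ 1 → s * 2 + δ ≡ s′ * 2 → s ≡ s′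
  split-δ (inj₁ refl) eq = *-cancelʳ-≡ s s′ 2 (trans (sym (+-identityʳ (s * 2))) eq)
  split-δ (inj₂ refl) eq = contradiction (trans (sym eq) (+-comm (s * 2) 1)) (m*2≢1+n*2 s′ s)

-- `δ` is the distance of two rows on `P`, equal or consecutive. Under equal shifts parity decides;
-- under different shifts the bound on nonzero slots leaves only the case that both are 0.
slot-clash : ∀ {h s s′ ε ε′ δ} → s ≡ 0 ⊎ 2 + s * 2 ≤ h → s′ ≡ 0 ⊎ 2 + s′ * 2 ≤ h →
  ε ≡ 0 ⊎ ε ≡ h → ε′ ≡ 0 ⊎ ε′ ≡ h → δ ≡ 0 ⊎ δ ≡ 1 →
  s * 2 + (ε + δ) ≡ s′ * 2 + ε′ → s ≡ s′
slot-clash _ _ (inj₁ refl) (inj₁ refl) δ∈ eq = slot-level 0 δ∈ eq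
slot-clash {h} _ _ (inj₂ refl) (inj₂ refl) δ∈ eq = slot-level h δ∈ eq
slot-clash {s = s} (inj₂ le) _ (inj₁ refl) (inj₂ refl) (inj₁ refl) eq =
  slot-apart le (trans (sym (+-identityʳ (s * 2))) eq)
slot-clash {s = s} (inj₂ le) _ (inj₁ refl) (inj₂ refl) (inj₂ refl) eq =
  slot-apart′ le (trans (+-comm 1 (s * 2)) eq)
slot-clash {s′ = s′} (inj₁ refl) _ (inj₁ refl) (inj₂ refl) (inj₁ refl) eq =
  sym (*-cancelʳ-≡ s′ 0 2 (m+n≡0⇒m≡0 (s′ * 2) (sym eq)))
slot-clash {s′ = zero} (inj₁ refl) _ (inj₁ refl) (inj₂ refl) (inj₂ refl) eq = refl
slot-clash {s′ = suc _} (inj₁ refl) _ (inj₁ refl) (inj₂ refl) (inj₂ refl) ()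
slot-clash {s = s} _ (inj₁ refl) (inj₂ refl) (inj₁ refl) _ eq = *-cancelʳ-≡ s 0 2 (m+n≡0⇒m≡0 (s * 2) eq)
slot-clash {h} {s} {s′} {δ = δ} _ (inj₂ le) (inj₂ refl) (inj₁ refl) _ eq = contradiction
  (≤-trans (m≤m+n h δ) (≤-trans (m≤n+m (h + δ) (s * 2)) (≤-reflexive (trans eq (+-identityʳ (s′ * 2))))))
  (<⇒≱ (≤-trans (n≤1+n _) le))

-- Positions of the rows on the path

module Strategy {G₀ c c′ P L b W} (h : ℕ) (two : ∀ k → k ≡ c ⊎ k ≡ c′) (path : InducedPath G₀ c P L)
  (below : ∀ q → q < L → P q < b) (bounded : Bounded G₀ b) (loopless : Loopless G₀)
  (layout : Layout h W L) where

  open Board h two path below bounded loopless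
  open Layout layout

  K : ℕ
  K = suc h

  Win : List Test → Set
  Win ts = MonoInducedCycle (4 + h * 2) (board ts)

  Wins : ℕ → List Test → Set
  Wins m ts = BuilderWins (4 + h * 2) m (board ts)

  cell : ℕ → ℕ → ℕ → ℕ
  cell j ε κ = seg j * W + (slot j * 2 + (ε + κ * d))

  -- The whole stretch of `P` spanned by the rows of link `j`, shifted or not, including what lies
  -- between them: arches and bridges of the link run inside it.
  Site : ℕ → ℕ → Set
  Site j q = ∃ λ y → y ≤ h + 3 * d × q ≡ seg j * W + (slot j * 2 + y)

  site-< : ∀ {j q} → j ≤ K → Site j q → q < L
  site-< {j} j≤K (y , y≤ , refl) =
    ≤-<-trans (+-monoʳ-≤ (seg j * W) (+-monoʳ-≤ (slot j * 2) y≤)) (inside j≤K)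

  cell-site : ∀ j {ε κ} → ε ≤ h → κ ≤ 3 → Site j (cell j ε κ)
  cell-site j {ε} {κ} ε≤h κ≤3 = ε + κ * d , +-mono-≤ ε≤h (*-monoˡ-≤ d κ≤3) , refl

  cell-< : ∀ {j ε κ} → j ≤ K → ε ≤ h → κ ≤ 3 → cell j ε κ < L
  cell-< {j} {ε} {κ} j≤K ε≤h κ≤3 = site-< j≤K (cell-site j {ε} {κ} ε≤h κ≤3)

  slot-< : ∀ {j y} → j ≤ K → y ≤ h + 3 * d → suc (slot j * 2 + y) < W
  slot-< {j} j≤K y≤ = ≤-<-trans (s≤s (+-monoʳ-≤ (slot j * 2) y≤)) (fits j≤K)

  site-seg : ∀ {i j q} → i ≤ K → j ≤ K → Site i q → Site j q → seg i ≡ seg j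
  site-seg {i} {j} i≤K j≤K (_ , y≤ , refl) (_ , y′≤ , eq) =
    proj₁ (euclid (seg i) (seg j) (<-trans (n<1+n _) (slot-< i≤K y≤)) (<-trans (n<1+n _) (slot-< j≤K y′≤)) eq)

  -- Cancels what depends on the link alone, so that `euclid` modulo `d` applies.
  row-eq : ∀ j ε ε′ κ κ′ {t t′} → cell j ε κ + t ≡ cell j ε′ κ′ + t′ → κ * d + (ε + t) ≡ κ′ * d + (ε′ + t′)
  row-eq j ε ε′ κ κ′ {t} {t′} eq = +-cancelˡ-≡ (seg j * W + slot j * 2) _ _
    (trans (sym (shuffle (seg j * W) (slot j * 2) ε (κ * d) t))
      (trans eq (shuffle (seg j * W) (slot j * 2) ε′ (κ′ * d) t′)))
    where
    shuffle : ∀ A B e x t → A + (B + (e + x)) + t ≡ (A + B) + (x + (e + t))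
    shuffle = solve-∀

  row-eq₀ : ∀ j ε κ κ′ {t} → cell j ε κ + t ≡ cell j ε κ′ → κ * d + t ≡ κ′ * d + 0
  row-eq₀ j ε κ κ′ {t} eq = +-cancelˡ-≡ ε _ _ (trans (swap ε (κ * d) t)
    (trans (row-eq j ε ε κ κ′ (trans eq (sym (+-identityʳ _)))) (sym (swap ε (κ′ * d) 0))))
    where
    swap : ∀ e x t → e + (x + t) ≡ x + (e + t)
    swap = solve-∀

  cell-injective : ∀ {j ε κ κ′} → cell j ε κ ≡ cell j ε κ′ → κ ≡ κ′
  cell-injective {j} {ε} {κ} {κ′} eq = proj₁ (euclid κ κ′ (s≤s z≤n) (s≤s z≤n)
    (row-eq₀ j ε κ κ′ (trans (+-identityʳ _) eq)))

  cell-suc : ∀ j ε κ → cell j ε (suc κ) ≡ cell j ε κ + d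
  cell-suc j ε κ = shuffle (seg j * W) (slot j * 2) ε d (κ * d)
    where
    shuffle : ∀ A B e d x → A + (B + (e + (d + x))) ≡ A + (B + (e + x)) + d
    shuffle = solve-∀

  cell-shift : ∀ j κ → cell j h κ ≡ cell j 0 κ + h
  cell-shift j κ = shuffle (seg j * W) (slot j * 2) h (κ * d)
    where
    shuffle : ∀ A B h x → A + (B + (h + x)) ≡ A + (B + x) + h
    shuffle = solve-∀

  h<d : h < d
  h<d = s≤s (≤-trans (m≤m*n h 2) (n≤1+n (h * 2)))

  -- Within the stretch of link `j`, vertex `i` is tested on rows of a single shift. The absence of
  -- chords thereby becomes a statement about remainders modulo `d`.
  Sited : List Test → ℕ → ℕ → ℕ → Set
  Sited ts i j ε = ∀ {q k} → (i , q , k) ∈ ts → Site j q → ∃ λ κ → q ≡ cell j ε κ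

  site-+ : ∀ j {ε κ t} → ε ≤ h → κ * d + t ≤ 3 * d → Site j (cell j ε κ + t)
  site-+ j {ε} {κ} {t} ε≤h le = ε + (κ * d + t) , +-mono-≤ ε≤h le ,
    shuffle (seg j * W) (slot j * 2) ε (κ * d) t
    where
    shuffle : ∀ A B e x t → A + (B + (e + x)) + t ≡ A + (B + (e + (x + t)))
    shuffle = solve-∀

  arch-at : ∀ {ts i j ε κ} → Inside ts → Sited ts i j ε → ε ≤ h → κ ≤ 2 →
    (i , cell j ε κ , c) ∈ ts → (i , cell j ε (suc κ) , c) ∈ ts → Win ts
  arch-at {ts} {i} {j} {ε} {κ} ins sited ε≤h κ≤2 t∈ t∈′ = arch ins (cell j ε κ) t∈
    (subst (λ q → (i , q , c) ∈ ts) (cell-suc j ε κ) t∈′) chord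
    where
    chord : ∀ t k → t ≤ d → (i , cell j ε κ + t , k) ∈ ts → t ≡ 0 ⊎ t ≡ d
    chord t k t≤d e∈ with m≤n⇒m<n∨m≡n t≤d
    ... | inj₂ t≡d = inj₂ t≡d
    ... | inj₁ t<d =
      let κ′ , eq = sited e∈ (site-+ j {κ = κ} ε≤h
                      (≤-trans (+-mono-≤ (*-monoˡ-≤ d κ≤2) t≤d) (≤-reflexive (+-comm (2 * d) d))))
      in inj₁ (proj₂ (euclid κ κ′ t<d (s≤s z≤n) (row-eq₀ j ε κ κ′ eq)))

  bridge-at : ∀ {ts i z j κ} → Inside ts → i ≢ z → Sited ts i j 0 → Sited ts z j h → κ ≤ 1 →
    (i , cell j 0 κ , c) ∈ ts → (i , cell j 0 (2 + κ) , c) ∈ ts →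
    (z , cell j h κ , c) ∈ ts → (z , cell j h (2 + κ) , c) ∈ ts → Win ts
  bridge-at {ts} {i} {z} {j} {κ} ins i≢z sited-i sited-z κ≤1 i∈ i∈₂ z∈ z∈₂ =
    bridge ins (cell j 0 κ) (cell j 0 (2 + κ)) i≢z gap i∈ i∈₂
      (subst (λ q → (z , q , c) ∈ ts) (cell-shift j κ) z∈)
      (subst (λ q → (z , q , c) ∈ ts) (cell-shift j (2 + κ)) z∈₂)
      (chord-i κ (m≤n⇒m≤o+n 2 κ≤1)) (chord-i (2 + κ) (s≤s (s≤s κ≤1)))
      (chord-z κ (m≤n⇒m≤o+n 2 κ≤1)) (chord-z (2 + κ) (s≤s (s≤s κ≤1)))
    where
    gap : cell j 0 κ + suc h < cell j 0 (2 + κ)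
    gap = subst (cell j 0 κ + suc h <_)
      (sym (trans (cell-suc j 0 (suc κ)) (trans (cong (_+ d) (cell-suc j 0 κ)) (+-assoc (cell j 0 κ) d d))))
      (+-monoʳ-< (cell j 0 κ) (<-≤-trans (s≤s h<d) (m<m+n d (s≤s z≤n))))

    in-site : ∀ κ {t} → κ ≤ 3 → t ≤ h → Site j (cell j 0 κ + t)
    in-site κ {t} κ≤3 t≤h = t + κ * d , +-mono-≤ t≤h (*-monoˡ-≤ d κ≤3) ,
      shuffle (seg j * W) (slot j * 2) (κ * d) t
      where
      shuffle : ∀ A B x t → A + (B + x) + t ≡ A + (B + (t + x))
      shuffle = solve-∀

    chord-i : ∀ κ → κ ≤ 3 → ∀ t k → t ≤ h → (i , cell j 0 κ + t , k) ∈ ts → t ≡ 0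
    chord-i κ κ≤3 t k t≤h e∈ =
      let κ′ , eq = sited-i e∈ (in-site κ κ≤3 t≤h)
      in proj₂ (euclid κ κ′ (≤-<-trans t≤h h<d) (s≤s z≤n) (row-eq₀ j 0 κ κ′ eq))

    -- Measured from unshifted rows, the tests of `z` have remainder `h` modulo `d`.
    chord-z : ∀ κ → κ ≤ 3 → ∀ t k → t ≤ h → (z , cell j 0 κ + t , k) ∈ ts → t ≡ h
    chord-z κ κ≤3 t k t≤h e∈ =
      let κ′ , eq = sited-z e∈ (in-site κ κ≤3 t≤h)
      in proj₂ (euclid κ κ′ (≤-<-trans t≤h h<d) h<d
           (row-eq j 0 0 κ κ′ (trans eq (cell-shift j κ′))))

  -- Testing a vertex along consecutive rows

  record Swept (ts : List Test) (i j ε κ r : ℕ) (ts′ : List Test) : Set where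
    field
      inside′ : Inside ts′
      old     : ∀ {t} → t ∈ ts → t ∈ ts′
      hit     : ∀ {s} → s < r → ∃ λ k → (i , cell j ε (s + κ) , k) ∈ ts′
      new     : ∀ {i′ q k} → (i′ , q , k) ∈ ts′ →
                (i′ , q , k) ∈ ts ⊎ (i′ ≡ i × ∃ λ s → s < r × q ≡ cell j ε (s + κ))

  -- Assumed before a sweep, both to make its edges new and to keep earlier tests from becoming
  -- chords.
  Clear : List Test → ℕ → ℕ → Set
  Clear ts i j = ∀ {q k} → (i , q , k) ∈ ts → ¬ Site j q

  sweep : ∀ {m ts} i j ε κ r → j ≤ K → ε ≤ h → r + κ ≤ 4 → Inside ts → Clear ts i j →
    (∀ ts′ → Swept ts i j ε κ r ts′ → Wins m ts′) → Wins (r + m) ts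
  sweep {ts = ts} i j ε κ zero j≤K ε≤h r≤4 ins clear next =
    next ts record { inside′ = ins ; old = id ; hit = λ () ; new = inj₁ }
  sweep {m} {ts} i j ε κ (suc r) j≤K ε≤h r≤4 ins clear next =
    subst (λ e → Wins e ts) (+-suc r m)
      (sweep i j ε κ r j≤K ε≤h (≤-trans (n≤1+n _) r≤4) ins clear λ ts′ sw →
        let open Swept sw in
        probe inside′ i (cell j ε (r + κ)) (cell-< {j} {ε} {r + κ} j≤K ε≤h (s≤s⁻¹ r≤4)) (untested sw)
          λ k → next ((i , cell j ε (r + κ) , k) ∷ ts′) record
            { inside′ = λ { (here refl) → cell-< {j} {ε} {r + κ} j≤K ε≤h (s≤s⁻¹ r≤4) ; (there t∈) → inside′ t∈ }
            ; old = there ∘ old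
            ; hit = λ {s} s<r → latest sw k s s<r
            ; new = λ { (here refl) → inj₂ (refl , r , ≤-refl , refl)
                      ; (there t∈) → Sum.map₂ (λ (i≡ , s , s<r , eq) → i≡ , s , m<n⇒m<1+n s<r , eq) (new t∈) } })
    where
    untested : ∀ {ts′} → Swept ts i j ε κ r ts′ → ∀ k → (i , cell j ε (r + κ) , k) ∉ ts′
    untested sw k t∈ with Swept.new sw t∈
    ... | inj₁ t∈′ = clear t∈′ (cell-site j {ε} {r + κ} ε≤h (s≤s⁻¹ r≤4))
    ... | inj₂ (_ , s , s<r , eq) = <-irrefl (sym (+-cancelʳ-≡ κ r s (cell-injective {j} {ε} eq))) s<r

    latest : ∀ {ts′} → Swept ts i j ε κ r ts′ → ∀ k s → s < suc r →
      ∃ λ k′ → (i , cell j ε (s + κ) , k′) ∈ (i , cell j ε (r + κ) , k) ∷ ts′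
    latest sw k s s<r with m≤n⇒m<n∨m≡n (s≤s⁻¹ s<r)
    ... | inj₁ s<r′ = let k′ , t∈ = Swept.hit sw s<r′ in k′ , there t∈
    ... | inj₂ refl = k , here refl

  swept-sited : ∀ {ts i j ε κ r ts′} → Clear ts i j → Swept ts i j ε κ r ts′ → Sited ts′ i j ε
  swept-sited clear sw t∈ site with Swept.new sw t∈
  ... | inj₁ t∈′                 = contradiction site (clear t∈′)
  ... | inj₂ (_ , s , _ , refl) = s + _ , refl

  swept-other : ∀ {ts i j ε κ r ts′ i′ q k} → i′ ≢ i → Swept ts i j ε κ r ts′ → (i′ , q , k) ∈ ts′ → (i′ , q , k) ∈ ts
  swept-other i′≢i sw t∈ with Swept.new sw t∈
  ... | inj₁ t∈′       = t∈′
  ... | inj₂ (i≡ , _) = contradiction i≡ i′≢i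

  -- In the second case the tested vertex j * 2 is only auxiliary, and the cycle goes through
  -- the untouched vertex suc (j * 2) instead.
  data Ready (ts : List Test) (j v : ℕ) : Set where
    double : ∀ κ → v ≡ j * 2 → κ ≤ 2 →
      (j * 2 , cell j 0 κ , c′) ∈ ts → (j * 2 , cell j 0 (suc κ) , c′) ∈ ts → Ready ts j v
    good   : ∀ κ → v ≡ suc (j * 2) → κ ≤ 1 →
      (j * 2 , cell j 0 κ , c) ∈ ts → (j * 2 , cell j 0 (2 + κ) , c) ∈ ts → Ready ts j v

  ready-mono : ∀ {ts ts′ j v} → (∀ {t} → t ∈ ts → t ∈ ts′) → Ready ts j v → Ready ts′ j v
  ready-mono sub (double κ v≡ κ≤ t∈ t∈′) = double κ v≡ κ≤ (sub t∈) (sub t∈′)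
  ready-mono sub (good κ v≡ κ≤ t∈ t∈′)   = good κ v≡ κ≤ (sub t∈) (sub t∈′)

  Prep : ℕ → ℕ → ℕ → Set
  Prep j i q = i ≡ j * 2 × ∃ λ κ → κ ≤ 3 × q ≡ cell j 0 κ

  Prepared : ℕ → List Test → Set
  Prepared j ts = ∀ {i q k} → (i , q , k) ∈ ts → ∃ λ j′ → j′ < j × Prep j′ i q

  prepared-inside : ∀ {j ts} → j ≤ suc K → Prepared j ts → Inside ts
  prepared-inside j≤ inv t∈ with _ , j′<j , _ , κ , κ≤3 , refl ← inv t∈ =
    cell-< {κ = κ} (s≤s⁻¹ (≤-trans j′<j j≤)) z≤n κ≤3

  prepare : ∀ {m ts} j → j ≤ K → Prepared j ts →
    (∀ ts′ → (∀ {t} → t ∈ ts → t ∈ ts′) → Prepared (suc j) ts′ → ∃ (Ready ts′ j) → Wins m ts′) →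
    Wins (4 + m) ts
  prepare {m} {ts} j j≤K inv next = sweep (j * 2) j 0 0 4 j≤K z≤n ≤-refl
    (prepared-inside (≤-trans j≤K (n≤1+n K)) inv) clear λ ts′ sw → conclude sw (outcome sw)
    where
    clear : Clear ts (j * 2) j
    clear t∈ _ with j′ , j′<j , eq , _ ← inv t∈ = <-irrefl (*-cancelʳ-≡ j′ j 2 (sym eq)) j′<j

    outcome : ∀ {ts′} → Swept ts (j * 2) j 0 0 4 ts′ → Win ts′ ⊎ ∃ (Ready ts′ j)
    outcome sw with hit (s≤s z≤n) | hit (s≤s (s≤s z≤n)) | hit (s≤s (s≤s (s≤s z≤n))) | hit (s≤s (s≤s (s≤s (s≤s z≤n))))
      where open Swept sw
    ... | k₀ , t₀ | k₁ , t₁ | k₂ , t₂ | k₃ , t₃ with two k₀ | two k₁ | two k₂ | two k₃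
    ... | inj₁ refl | inj₁ refl | _         | _         = inj₁ (arch-at (Swept.inside′ sw) (swept-sited clear sw) z≤n z≤n t₀ t₁)
    ... | inj₂ refl | inj₂ refl | _         | _         = inj₂ (_ , double 0 refl z≤n t₀ t₁)
    ... | _         | inj₁ refl | inj₁ refl | _         = inj₁ (arch-at (Swept.inside′ sw) (swept-sited clear sw) z≤n (s≤s z≤n) t₁ t₂)
    ... | _         | inj₂ refl | inj₂ refl | _         = inj₂ (_ , double 1 refl (s≤s z≤n) t₁ t₂)
    -- The first three rows now alternate. If they begin with `c` they suffice; if with `c′`, the
    -- fourth row decides between `good` and `double`.
    ... | inj₁ refl | inj₂ refl | inj₁ refl | _         = inj₂ (_ , good 0 refl z≤n t₀ t₂)
    ... | inj₂ refl | inj₁ refl | inj₂ refl | inj₁ refl = inj₂ (_ , good 1 refl (s≤s z≤n) t₁ t₃)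
    ... | inj₂ refl | inj₁ refl | inj₂ refl | inj₂ refl = inj₂ (_ , double 2 refl (s≤s (s≤s z≤n)) t₂ t₃)

    conclude : ∀ {ts′} → Swept ts (j * 2) j 0 0 4 ts′ → Win ts′ ⊎ ∃ (Ready ts′ j) → Wins m ts′
    conclude sw (inj₁ win)   = done win
    conclude sw (inj₂ ready) = next _ (Swept.old sw) (λ t∈ → Sum.[ old-test , new-test ] (Swept.new sw t∈)) ready
      where
      old-test : ∀ {i q k} → (i , q , k) ∈ ts → ∃ λ j′ → j′ < suc j × Prep j′ i q
      old-test t∈ with j′ , j′<j , p ← inv t∈ = j′ , m<n⇒m<1+n j′<j , p

      new-test : ∀ {i q} → i ≡ j * 2 × (∃ λ s → s < 4 × q ≡ cell j 0 (s + 0)) → ∃ λ j′ → j′ < suc j × Prep j′ i q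
      new-test (i≡ , s , s<4 , q≡) =
        j , ≤-refl , i≡ , s , s≤s⁻¹ s<4 , trans q≡ (cong (cell j 0) (+-identityʳ s))

  prepare-all : ∀ {m ts} r j → j + r ≡ suc K → Prepared j ts → (∀ j′ → j′ < j → ∃ (Ready ts j′)) →
    (∀ ts′ → Prepared (suc K) ts′ → (∀ j′ → j′ < suc K → ∃ (Ready ts′ j′)) → Wins m ts′) →
    Wins (r * 4 + m) ts
  prepare-all zero j eq inv ready next
    with refl ← trans (sym (+-identityʳ j)) eq = next _ inv ready
  prepare-all {ts = ts} (suc r) j eq inv ready next =
    prepare j (s≤s⁻¹ (subst (suc j ≤_) eq′ (m≤m+n (suc j) r))) inv
      λ ts′ sub inv′ ready′ → prepare-all r (suc j) eq′ inv′ (all sub ready′) next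
    where
    eq′ : suc j + r ≡ suc K
    eq′ = trans (sym (+-suc j r)) eq

    all : ∀ {ts′} → (∀ {t} → t ∈ ts → t ∈ ts′) → ∃ (Ready ts′ j) → ∀ j′ → j′ < suc j → ∃ (Ready ts′ j′)
    all sub ready′ j′ j′<1+j with m≤n⇒m<n∨m≡n (s≤s⁻¹ j′<1+j)
    ... | inj₁ j′<j = let v , r = ready j′ j′<j in v , ready-mono sub r
    ... | inj₂ refl = ready′

  -- Rows of different links

  Row : ℕ → ℕ → Set
  Row j q = ∃₂ λ ε κ → (ε ≡ 0 ⊎ ε ≡ h) × κ ≤ 3 × q ≡ cell j ε κ

  shift-≤ : ∀ {ε} → ε ≡ 0 ⊎ ε ≡ h → ε ≤ h
  shift-≤ (inj₁ refl) = z≤n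
  shift-≤ (inj₂ refl) = ≤-refl

  row-site : ∀ {j q} → Row j q → Site j q
  row-site {j} (ε , κ , ε∈ , κ≤3 , refl) = cell-site j {ε} {κ} (shift-≤ ε∈) κ≤3

  -- Division by `W` identifies the segment; division of the offset by `d` leaves twice the slot
  -- plus the shift, to which `slot-clash` applies. Hence the vertices chosen on `P` for different
  -- links are distinct and nonadjacent.
  row-clash : ∀ {i j q q′} → i ≤ K → j ≤ K → Row i q → Row j q′ → q′ ≡ q ⊎ q′ ≡ suc q → i ≡ j
  row-clash {i} {j} i≤K j≤K (ε , κ , ε∈ , κ≤3 , refl) (ε′ , κ′ , ε′∈ , κ′≤3 , refl) near =
    Sum.[ (λ eq → clash 0 (inj₁ refl) (trans (+-identityʳ _) (sym eq)))
        , (λ eq → clash 1 (inj₂ refl) (trans (+-comm _ 1) (sym eq))) ] near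
    where
    y y′ : ℕ
    y  = ε + κ * d
    y′ = ε′ + κ′ * d

    y≤ : y ≤ h + 3 * d
    y≤ = +-mono-≤ (shift-≤ ε∈) (*-monoˡ-≤ d κ≤3)

    y′≤ : y′ ≤ h + 3 * d
    y′≤ = +-mono-≤ (shift-≤ ε′∈) (*-monoˡ-≤ d κ′≤3)

    slot≤h : ∀ {j} → j ≤ K → slot j * 2 ≤ h
    slot≤h j≤K = Sum.[ (λ eq → subst (λ s → s * 2 ≤ h) (sym eq) z≤n) , (λ le → ≤-trans (m≤n+m _ 2) le) ] (small j≤K)

    -- Slot offset and shift are at most `h` each, and `h + h + 1 < d`.
    remainder-< : ∀ {a e x} → a ≤ h → e ≤ h → x ≤ 1 → a + (e + x) < d
    remainder-< {a} {e} {x} a≤h e≤h x≤1 = s≤s (≤-trans (+-mono-≤ a≤h (+-mono-≤ e≤h x≤1)) (≤-reflexive (total h)))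
      where
      total : ∀ h → h + (h + 1) ≡ suc (h * 2)
      total = solve-∀

    shuffle : ∀ A a e x t → A + (a + (e + x)) + t ≡ A + (a + (e + x) + t)
    shuffle = solve-∀

    regroup : ∀ a e x t → a + (e + x) + t ≡ x + (a + (e + t))
    regroup = solve-∀

    clash : ∀ δ → δ ≡ 0 ⊎ δ ≡ 1 → cell i ε κ + δ ≡ cell j ε′ κ′ → i ≡ j
    clash δ δ∈ eq =
      let seg≡ , rest = euclid (seg i) (seg j)
            (≤-<-trans (≤-trans (+-monoʳ-≤ (slot i * 2 + y) δ≤1) (≤-reflexive (+-comm _ 1))) (slot-< i≤K y≤))
            (<-trans (n<1+n _) (slot-< j≤K y′≤))
            (trans (sym (shuffle (seg i * W) (slot i * 2) ε (κ * d) δ)) eq)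
          _ , rem = euclid κ κ′ (remainder-< (slot≤h i≤K) (shift-≤ ε∈) δ≤1)
            (remainder-< {x = 0} (slot≤h j≤K) (shift-≤ ε′∈) z≤n)
            (trans (sym (regroup (slot i * 2) ε (κ * d) δ))
              (trans rest (trans (sym (+-identityʳ _)) (regroup (slot j * 2) ε′ (κ′ * d) 0))))
      in determined i≤K j≤K seg≡ (slot-clash (small i≤K) (small j≤K) ε∈ ε′∈ δ∈
           (trans rem (cong (slot j * 2 +_) (+-identityʳ ε′))))
      where
      δ≤1 : δ ≤ 1
      δ≤1 = Sum.[ (λ { refl → z≤n }) , (λ { refl → ≤-refl }) ] δ∈

  -- Each position of the cycle has two new vertices reserved for it, of which `Ready` selects one.
  Bit : ℕ → ℕ → Set
  Bit j v = v ≡ j * 2 ⊎ v ≡ suc (j * 2)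

  bit-injective : ∀ {i j v} → Bit i v → Bit j v → i ≡ j
  bit-injective {i} {j} (inj₁ refl) (inj₁ eq) = *-cancelʳ-≡ i j 2 eq
  bit-injective {i} {j} (inj₁ refl) (inj₂ eq) = contradiction eq (m*2≢1+n*2 i j)
  bit-injective {i} {j} (inj₂ refl) (inj₁ eq) = contradiction (sym eq) (m*2≢1+n*2 j i)
  bit-injective {i} {j} (inj₂ refl) (inj₂ eq) = *-cancelʳ-≡ i j 2 (suc-injective eq)

  ready-bit : ∀ {ts j v} → Ready ts j v → Bit j v
  ready-bit (double _ v≡ _ _ _) = inj₁ v≡
  ready-bit (good _ v≡ _ _ _)   = inj₂ v≡

  Triple : List Test → ℕ → ℕ → ℕ → Set
  Triple ts z j κ = (at 0 × at 1) ⊎ (at 1 × at 2) ⊎ (at 0 × at 2)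
    where
    at : ℕ → Set
    at s = (z , cell j h (s + κ) , c′) ∈ ts

  -- Two consecutive rows in `c` give an arch, and `c`, `c′`, `c` gives a bridge with the auxiliary
  -- vertex `i`. Every other pattern contains `c′` twice.
  triple : ∀ {ts i z j κ} → Inside ts → i ≢ z → Sited ts i j 0 → Sited ts z j h → κ ≤ 1 →
    (i , cell j 0 κ , c) ∈ ts → (i , cell j 0 (2 + κ) , c) ∈ ts →
    (∀ {s} → s < 3 → ∃ λ k → (z , cell j h (s + κ) , k) ∈ ts) → Win ts ⊎ Triple ts z j κ
  triple ins i≢z sited-i sited-z κ≤1 i∈ i∈₂ hit
    with hit (s≤s z≤n) | hit (s≤s (s≤s z≤n)) | hit (s≤s (s≤s (s≤s z≤n)))
  ... | k₀ , t₀ | k₁ , t₁ | k₂ , t₂ with two k₀ | two k₁ | two k₂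
  ... | inj₁ refl | inj₁ refl | _         = inj₁ (arch-at ins sited-z ≤-refl (m≤n⇒m≤1+n κ≤1) t₀ t₁)
  ... | _         | inj₁ refl | inj₁ refl = inj₁ (arch-at ins sited-z ≤-refl (s≤s κ≤1) t₁ t₂)
  ... | inj₁ refl | inj₂ refl | inj₁ refl = inj₁ (bridge-at ins i≢z sited-i sited-z κ≤1 i∈ i∈₂ t₀ t₂)
  ... | inj₂ refl | inj₂ refl | _         = inj₂ (inj₁ (t₀ , t₁))
  ... | inj₁ refl | inj₂ refl | inj₂ refl = inj₂ (inj₂ (inj₁ (t₁ , t₂)))
  ... | inj₂ refl | inj₁ refl | inj₂ refl = inj₂ (inj₂ (inj₂ (t₀ , t₂)))

  Joint : List Test → ℕ → ℕ → ℕ → Set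
  Joint ts j v u = ∃ λ q → Row j q × (v , q , c′) ∈ ts × (u , q , c′) ∈ ts

  joint-mono : ∀ {ts ts′ j v u} → (∀ {t} → t ∈ ts → t ∈ ts′) → Joint ts j v u → Joint ts′ j v u
  joint-mono sub (q , row , v∈ , u∈) = q , row , sub v∈ , sub u∈

  -- Two pairs out of the same three rows intersect.
  common : ∀ {ts j κ v u} → κ ≤ 1 → Triple ts v j κ → Triple ts u j κ → Joint ts j v u
  common {ts} {j} {κ} {v} {u} κ≤1 = meet
    where
    joint : ∀ s → s ≤ 2 → (v , cell j h (s + κ) , c′) ∈ ts → (u , cell j h (s + κ) , c′) ∈ ts → Joint ts j v u
    joint s s≤2 v∈ u∈ = cell j h (s + κ) , (h , s + κ , inj₂ refl , +-mono-≤ s≤2 κ≤1 , refl) , v∈ , u∈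

    meet : Triple ts v j κ → Triple ts u j κ → Joint ts j v u
    meet (inj₁ (v₀ , _))        (inj₁ (u₀ , _))        = joint 0 z≤n v₀ u₀
    meet (inj₁ (_ , v₁))        (inj₂ (inj₁ (u₁ , _))) = joint 1 (s≤s z≤n) v₁ u₁
    meet (inj₁ (v₀ , _))        (inj₂ (inj₂ (u₀ , _))) = joint 0 z≤n v₀ u₀
    meet (inj₂ (inj₁ (v₁ , _))) (inj₁ (_ , u₁))        = joint 1 (s≤s z≤n) v₁ u₁
    meet (inj₂ (inj₁ (v₁ , _))) (inj₂ (inj₁ (u₁ , _))) = joint 1 (s≤s z≤n) v₁ u₁
    meet (inj₂ (inj₁ (_ , v₂))) (inj₂ (inj₂ (_ , u₂))) = joint 2 ≤-refl v₂ u₂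
    meet (inj₂ (inj₂ (v₀ , _))) (inj₁ (u₀ , _))        = joint 0 z≤n v₀ u₀
    meet (inj₂ (inj₂ (_ , v₂))) (inj₂ (inj₁ (_ , u₂))) = joint 2 ≤-refl v₂ u₂
    meet (inj₂ (inj₂ (v₀ , _))) (inj₂ (inj₂ (u₀ , _))) = joint 0 z≤n v₀ u₀

  -- Connecting the new vertices to a cycle

  module Link (y : ℕ → ℕ) (bit : ∀ {j} → j ≤ K → Bit j (y j)) where

    -- The invariant once the links before `j` are made: each test is a preparation, or lies on a
    -- row of a finished link at one of its two ends. It excludes chords in the final cycle.
    Connected : ℕ → List Test → Set
    Connected j ts = ∀ {i q k} → (i , q , k) ∈ ts →
      (∃ λ j′ → j′ ≤ K × Prep j′ i q) ⊎ (∃ λ j′ → j′ < j × (i ≡ y j′ ⊎ i ≡ y (nxt K j′)) × Row j′ q)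

    prep-row : ∀ {j i q} → Prep j i q → Row j q
    prep-row (_ , κ , κ≤3 , q≡) = 0 , κ , inj₁ refl , κ≤3 , q≡

    connected-inside : ∀ {j ts} → j ≤ suc K → Connected j ts → Inside ts
    connected-inside j≤ inv t∈ with inv t∈
    ... | inj₁ (j′ , j′≤K , p) = site-< j′≤K (row-site (prep-row p))
    ... | inj₂ (j′ , j′<j , _ , row) = site-< (s≤s⁻¹ (≤-trans j′<j j≤)) (row-site row)

    -- Different positions have different vertices, so a vertex of position `a` is tested only on
    -- rows of link `a` or of the link leading into it.
    owner : ∀ {j ts a v q k} → j ≤ suc K → Connected j ts → Bit a v → (v , q , k) ∈ ts →
      (v ≡ a * 2 × Row a q) ⊎ (a < j × Row a q) ⊎ (∃ λ j′ → j′ < j × nxt K j′ ≡ a × Row j′ q)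
    owner {a = a} j≤ inv b t∈ with inv t∈
    ... | inj₁ (j′ , _ , p@(v≡ , _)) with refl ← bit-injective {j′} {a} (inj₁ v≡) b = inj₁ (v≡ , prep-row p)
    owner {a = a} j≤ inv b t∈ | inj₂ (j′ , j′<j , inj₁ refl , row)
      with refl ← bit-injective {j′} {a} (bit (s≤s⁻¹ (≤-trans j′<j j≤))) b = inj₂ (inj₁ (j′<j , row))
    owner {a = a} j≤ inv b t∈ | inj₂ (j′ , j′<j , inj₂ refl , row) =
      inj₂ (inj₂ (j′ , j′<j , bit-injective {nxt K j′} {a} (bit (nxt-≤ (s≤s⁻¹ (≤-trans j′<j j≤)))) b , row))

    module At {ts j} (j≤K : j ≤ K) (inv : Connected j ts) where

      u : ℕ
      u = y (nxt K j)

      j≤ : j ≤ suc K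
      j≤ = ≤-trans j≤K (n≤1+n K)

      -- Earlier tests of `u` lie on rows of its own link, in another segment by `alternate`. The
      -- link leading into `u` is `j` itself and not yet made.
      clear-next : Clear ts u j
      clear-next t∈ site with owner j≤ inv (bit (nxt-≤ j≤K)) t∈
      ... | inj₁ (_ , row) = alternate j≤K (site-seg (nxt-≤ j≤K) j≤K (row-site row) site)
      ... | inj₂ (inj₁ (_ , row)) = alternate j≤K (site-seg (nxt-≤ j≤K) j≤K (row-site row) site)
      ... | inj₂ (inj₂ (j′ , j′<j , eq , _)) = <-irrefl (nxt-injective {K} eq) j′<j

      clear-self : y j ≡ suc (j * 2) → Clear ts (y j) j
      clear-self odd t∈ site with owner j≤ inv (bit j≤K) t∈
      ... | inj₁ (even , _) = m*2≢1+n*2 j j (trans (sym even) odd)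
      ... | inj₂ (inj₁ (j<j , _)) = <-irrefl refl j<j
      ... | inj₂ (inj₂ (j′ , j′<j , refl , row)) = alternate j′≤K (sym (site-seg j′≤K j≤K (row-site row) site))
        where
        j′≤K : j′ ≤ K
        j′≤K = ≤-trans (<⇒≤ j′<j) j≤K

      -- The cycle goes through `suc (j * 2)`, so `j * 2` is an end of no link and has only
      -- preparation tests.
      aux-sited : y j ≡ suc (j * 2) → Sited ts (j * 2) j 0
      aux-sited odd t∈ site with inv t∈
      ... | inj₁ (j′ , _ , eq , κ , _ , q≡) with refl ← *-cancelʳ-≡ j j′ 2 eq = κ , q≡
      aux-sited odd t∈ site | inj₂ (j′ , j′<j , inj₁ eq , _) =
        contradiction (bit-injective (subst (Bit j′) (sym eq) (bit (≤-trans (<⇒≤ j′<j) j≤K))) (inj₁ refl)) (<⇒≢ j′<j)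
      aux-sited odd t∈ site | inj₂ (j′ , j′<j , inj₂ eq , _)
        with bit-injective (subst (Bit (nxt K j′)) (sym eq) (bit (nxt-≤ (≤-trans (<⇒≤ j′<j) j≤K)))) (inj₁ refl)
      ... | nxt≡j = contradiction (trans eq (trans (cong y nxt≡j) odd)) (m*2≢1+n*2 j j)

      u≢self : u ≢ y j
      u≢self eq = alternate j≤K (cong seg (bit-injective (bit (nxt-≤ j≤K)) (subst (Bit j) (sym eq) (bit j≤K))))

      u≢aux : u ≢ j * 2
      u≢aux eq = alternate j≤K (cong seg (bit-injective (bit (nxt-≤ j≤K)) (inj₁ eq)))

      carry : ∀ {ts′ i ε κ r} → (i ≡ y j ⊎ i ≡ u) → ε ≡ 0 ⊎ ε ≡ h → r + κ ≤ 4 →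
        ∀ {ts₁} → Connected (suc j) ts₁ → Swept ts₁ i j ε κ r ts′ → Connected (suc j) ts′
      carry {κ = κ} {r} i∈ ε∈ r≤4 inv₁ sw t∈ with Swept.new sw t∈
      ... | inj₁ t∈′ = inv₁ t∈′
      ... | inj₂ (refl , s , s<r , refl) =
        inj₂ (j , ≤-refl , i∈ , _ , s + κ , ε∈ , s≤s⁻¹ (≤-trans (+-monoˡ-≤ κ s<r) r≤4) , refl)

      inv⁺ : Connected (suc j) ts
      inv⁺ t∈ = Sum.map₂ (λ (j′ , j′<j , rest) → j′ , m<n⇒m<1+n j′<j , rest) (inv t∈)

      connect : ∀ {m} → Ready ts j (y j) →
        (∀ ts′ → (∀ {t} → t ∈ ts → t ∈ ts′) → Connected (suc j) ts′ → Joint ts′ j (y j) u → Wins m ts′) →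
        Wins (6 + m) ts
      -- Two tests on `u` suffice here; the allowance of six comes from the `good` case, with three
      -- at each end.
      connect {m} (double κ v≡ κ≤2 v∈ v∈′) next = weaken (+-monoˡ-≤ m {2} (s≤s (s≤s z≤n)))
        (sweep u j 0 κ 2 j≤K z≤n (s≤s (s≤s κ≤2)) (connected-inside j≤ inv) clear-next λ ts′ sw →
          conclude sw (outcome sw))
        where
        outcome : ∀ {ts′} → Swept ts u j 0 κ 2 ts′ → Win ts′ ⊎ Joint ts′ j (y j) u
        outcome sw with hit (s≤s z≤n) | hit (s≤s (s≤s z≤n))
          where open Swept sw
        ... | k₀ , t₀ | k₁ , t₁ with two k₀ | two k₁
        ... | inj₁ refl | inj₁ refl = inj₁ (arch-at (Swept.inside′ sw) (swept-sited clear-next sw) z≤n κ≤2 t₀ t₁)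
        ... | inj₂ refl | _ = inj₂ (cell j 0 κ , (0 , κ , inj₁ refl , m≤n⇒m≤1+n κ≤2 , refl) ,
          subst (λ v → (v , cell j 0 κ , c′) ∈ _) (sym v≡) (Swept.old sw v∈) , t₀)
        ... | inj₁ refl | inj₂ refl = inj₂ (cell j 0 (suc κ) , (0 , suc κ , inj₁ refl , s≤s κ≤2 , refl) ,
          subst (λ v → (v , cell j 0 (suc κ) , c′) ∈ _) (sym v≡) (Swept.old sw v∈′) , t₁)

        conclude : ∀ {ts′} → Swept ts u j 0 κ 2 ts′ → Win ts′ ⊎ Joint ts′ j (y j) u → Wins m ts′
        conclude sw (inj₁ win)   = done win
        conclude sw (inj₂ joint) = next _ (Swept.old sw)
          (carry (inj₂ refl) (inj₁ refl) (s≤s (s≤s κ≤2)) inv⁺ sw) joint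
      connect {m} (good κ v≡ κ≤1 i∈ i∈₂) next =
        sweep u j h κ 3 j≤K ≤-refl (s≤s (s≤s (s≤s κ≤1))) (connected-inside j≤ inv) clear-next λ ts₁ sw₁ →
        sweep (y j) j h κ 3 j≤K ≤-refl (s≤s (s≤s (s≤s κ≤1))) (Swept.inside′ sw₁) (clear₁ sw₁) λ ts₂ sw₂ →
        conclude sw₁ sw₂
        where
        clear₁ : ∀ {ts₁} → Swept ts u j h κ 3 ts₁ → Clear ts₁ (y j) j
        clear₁ sw₁ t∈ = clear-self v≡ (swept-other (u≢self ∘ sym) sw₁ t∈)

        self≢aux : y j ≢ j * 2
        self≢aux eq = m*2≢1+n*2 j j (trans (sym eq) v≡)

        conclude : ∀ {ts₁ ts₂} → Swept ts u j h κ 3 ts₁ → Swept ts₁ (y j) j h κ 3 ts₂ → Wins m ts₂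
        conclude {ts₁} {ts₂} sw₁ sw₂ = decide
          (triple inside′ (u≢aux ∘ sym) sited-aux sited-u κ≤1 (old′ i∈) (old′ i∈₂) hit-u)
          (triple inside′ (self≢aux ∘ sym) sited-aux (swept-sited (clear₁ sw₁) sw₂) κ≤1 (old′ i∈) (old′ i∈₂) (Swept.hit sw₂))
          where
          open Swept sw₂ using (inside′)

          old′ : ∀ {t} → t ∈ ts → t ∈ ts₂
          old′ = Swept.old sw₂ ∘ Swept.old sw₁

          sited-aux : Sited ts₂ (j * 2) j 0
          sited-aux = aux-sited v≡ ∘ swept-other (u≢aux ∘ sym) sw₁ ∘ swept-other (self≢aux ∘ sym) sw₂

          sited-u : Sited ts₂ u j h
          sited-u = swept-sited clear-next sw₁ ∘ swept-other u≢self sw₂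

          hit-u : ∀ {s} → s < 3 → ∃ λ k → (u , cell j h (s + κ) , k) ∈ ts₂
          hit-u s<3 = let k , t∈ = Swept.hit sw₁ s<3 in k , Swept.old sw₂ t∈

          decide : Win ts₂ ⊎ Triple ts₂ u j κ → Win ts₂ ⊎ Triple ts₂ (y j) j κ → Wins m ts₂
          decide (inj₁ win) _          = done win
          decide (inj₂ _)   (inj₁ win) = done win
          decide (inj₂ tu)  (inj₂ tv)  = next ts₂ old′
            (carry (inj₁ refl) (inj₂ refl) (s≤s (s≤s (s≤s κ≤1)))
              (carry (inj₂ refl) (inj₂ refl) (s≤s (s≤s (s≤s κ≤1))) inv⁺ sw₁) sw₂)
            (common κ≤1 tv tu)

    connect-all : ∀ {m ts} r j → j + r ≡ suc K → Connected j ts → (∀ {j′} → j′ ≤ K → Ready ts j′ (y j′)) →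
      (∀ j′ → j′ < j → Joint ts j′ (y j′) (y (nxt K j′))) →
      (∀ ts′ → Connected (suc K) ts′ → (∀ j′ → j′ < suc K → Joint ts′ j′ (y j′) (y (nxt K j′))) → Wins m ts′) →
      Wins (r * 6 + m) ts
    connect-all zero j eq inv ready joints next
      with refl ← trans (sym (+-identityʳ j)) eq = next _ inv joints
    connect-all {ts = ts} (suc r) j eq inv ready joints next =
      At.connect j≤K inv (ready j≤K) λ ts′ sub inv′ joint →
        connect-all r (suc j) eq′ inv′ (ready-mono sub ∘ ready) (all sub joint) next
      where
      eq′ : suc j + r ≡ suc K
      eq′ = trans (sym (+-suc j r)) eq

      j≤K : j ≤ K
      j≤K = s≤s⁻¹ (subst (suc j ≤_) eq′ (m≤m+n (suc j) r))

      all : ∀ {ts′} → (∀ {t} → t ∈ ts → t ∈ ts′) → Joint ts′ j (y j) (y (nxt K j)) →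
        ∀ j′ → j′ < suc j → Joint ts′ j′ (y j′) (y (nxt K j′))
      all sub joint j′ j′<1+j with m≤n⇒m<n∨m≡n (s≤s⁻¹ j′<1+j)
      ... | inj₁ j′<j = joint-mono sub (joints j′ j′<j)
      ... | inj₂ refl = joint

    -- `Q K` closes the `2K + 1` vertices from `Y 0` to `Y K` to a cycle on `2K + 2 = 4 + 2h`.
    -- Chords between vertices of `P` are excluded by `row-clash`, those between new vertices and
    -- `P` by `owner` as well.
    finish : ∀ {ts} → Connected (suc K) ts → (∀ j → j < suc K → Joint ts j (y j) (y (nxt K j))) → Win ts
    finish {ts} inv joints with choice (suc K) joints
    ... | p , joint = close-path (Q K) (board-loopless ins)
      (braid-path K Y Q (λ j j<K → own (<⇒≤ j<K)) (λ j j<K → subst (λ e → AdjCol (board ts) c′ (Y e) (Q j)) (nxt-suc j<K) (other (<⇒≤ j<K)))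
        (λ i j i≤K j≤K i≢j → (λ eq → i≢j (Y-injective i≤K j≤K eq)) , adj-extra ins)
        (λ i j i<K j<K i≢j → (λ eq → i≢j (Q-injective (<⇒≤ i<K) (<⇒≤ j<K) eq)) , QQ (<⇒≤ i<K) (<⇒≤ j<K) i≢j)
        (λ i j i≤K j<K → Y≢Q (<⇒≤ j<K) , λ adj → Sum.map₂ (λ eq → trans eq (nxt-suc j<K)) (YQ i≤K (<⇒≤ j<K) adj)))
      (adjCol-sym (subst (λ e → AdjCol (board ts) c′ (Y e) (Q K)) (nxt-last K) (other ≤-refl)))
      (adjCol-sym (subst (λ v → AdjCol (board ts) c′ v (Q K)) (sym (braid-even Y Q K)) (own ≤-refl)))
      fresh only
      where
      Y Q : ℕ → ℕ
      Y j = b + y j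
      Q j = P (p j)

      ins : Inside ts
      ins = connected-inside ≤-refl inv

      row : ∀ {j} → j ≤ K → Row j (p j)
      row j≤K = proj₁ (joint _ (s≤s j≤K))

      p< : ∀ {j} → j ≤ K → p j < L
      p< j≤K = site-< j≤K (row-site (row j≤K))

      own : ∀ {j} → j ≤ K → AdjCol (board ts) c′ (Y j) (Q j)
      own j≤K = board-col (proj₁ (proj₂ (joint _ (s≤s j≤K))))

      other : ∀ {j} → j ≤ K → AdjCol (board ts) c′ (Y (nxt K j)) (Q j)
      other j≤K = board-col (proj₂ (proj₂ (joint _ (s≤s j≤K))))

      Y-injective : ∀ {i j} → i ≤ K → j ≤ K → Y i ≡ Y j → i ≡ j
      Y-injective {i} {j} i≤K j≤K eq = bit-injective (bit i≤K) (subst (Bit j) (sym (+-cancelˡ-≡ b _ _ eq)) (bit j≤K))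

      Q-injective : ∀ {i j} → i ≤ K → j ≤ K → Q i ≡ Q j → i ≡ j
      Q-injective i≤K j≤K eq = row-clash i≤K j≤K (row i≤K) (row j≤K) (inj₁ (sym (P-injective (p< i≤K) (p< j≤K) eq)))

      Y≢Q : ∀ {i j} → j ≤ K → Y i ≢ Q j
      Y≢Q j≤K = extra≢path (p< j≤K)

      QQ : ∀ {i j} → i ≤ K → j ≤ K → i ≢ j → ¬ Adj (board ts) (Q i) (Q j)
      QQ {i} {j} i≤K j≤K i≢j adj with adj-path ins (p< i≤K) (p< j≤K) adj
      ... | adj₀ with <-cmp (p i) (p j)
      ... | tri< lt _ _ = i≢j (row-clash i≤K j≤K (row i≤K) (row j≤K) (inj₂ (path .induced _ _ lt (p< j≤K) adj₀)))
      ... | tri≈ _ eq _ = i≢j (row-clash i≤K j≤K (row i≤K) (row j≤K) (inj₁ (sym eq)))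
      ... | tri> _ _ gt = i≢j (sym (row-clash j≤K i≤K (row j≤K) (row i≤K) (inj₂ (path .induced _ _ gt (p< i≤K) (adj-sym adj₀)))))

      YQ : ∀ {i j} → i ≤ K → j ≤ K → Adj (board ts) (Y i) (Q j) → i ≡ j ⊎ i ≡ nxt K j
      YQ i≤K j≤K adj with adj-extra-path ins (p< j≤K) adj
      ... | _ , t∈ with owner ≤-refl inv (bit i≤K) t∈
      ... | inj₁ (_ , row′) = inj₁ (row-clash i≤K j≤K row′ (row j≤K) (inj₁ refl))
      ... | inj₂ (inj₁ (_ , row′)) = inj₁ (row-clash i≤K j≤K row′ (row j≤K) (inj₁ refl))
      ... | inj₂ (inj₂ (j′ , j′<K , nxt≡i , row′))
        with refl ← row-clash (s≤s⁻¹ j′<K) j≤K row′ (row j≤K) (inj₁ refl) = inj₂ (sym nxt≡i)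

      fresh : ∀ i → i ≤ K * 2 → Q K ≢ braid Y Q i
      fresh i i≤ with braid-view Y Q i
      ... | inj₁ (a , refl , eq) = subst (Q K ≢_) (sym eq) (Y≢Q ≤-refl ∘ sym)
      ... | inj₂ (a , refl , eq) = subst (Q K ≢_) (sym eq)
        λ Q≡ → <-irrefl (sym (Q-injective ≤-refl (<⇒≤ (half-<′ (s≤s i≤))) Q≡)) (half-<′ (s≤s i≤))

      only : ∀ i → i ≤ K * 2 → Adj (board ts) (Q K) (braid Y Q i) → i ≡ 0 ⊎ i ≡ K * 2
      only i i≤ adj with braid-view Y Q i
      ... | inj₁ (a , refl , eq) = Sum.swap (Sum.map (cong (_* 2)) (λ a≡ → cong (_* 2) (trans a≡ (nxt-last K)))
        (YQ (half-< (s≤s i≤)) ≤-refl (adj-sym (subst (Adj (board ts) (Q K)) eq adj))))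
      ... | inj₂ (a , refl , eq) = contradiction (subst (Adj (board ts) (Q K)) eq adj)
        (QQ ≤-refl (<⇒≤ (half-<′ (s≤s i≤))) (<⇒≢ (half-<′ {a} {K} (s≤s i≤)) ∘ sym))

  -- Each of the `h + 2` links takes four tests to prepare and at most six to connect.
  win : BuilderWins (4 + h * 2) (suc K * 4 + (suc K * 6 + 0)) G₀
  win = prepare-all {ts = []} (suc K) 0 refl (λ ()) (λ _ ()) λ ts inv readies →
    let y , ready = choice (suc K) readies
        open Link y (λ j≤K → ready-bit (ready _ (s≤s j≤K)))
    in connect-all (suc K) 0 refl
         (λ t∈ → let j , j<K , p = inv t∈ in inj₁ (j , s≤s⁻¹ j<K , p))
         (λ j≤K → ready _ (s≤s j≤K)) (λ _ ()) λ ts′ inv′ joints → done {n = 4 + h * 2} (finish inv′ joints)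

-- Layout of the links

-- The least segment length that `fits` allows for slot `s`: rows reach `h + 3d` past the offset,
-- and one spare position keeps rows of neighbouring segments from being consecutive.
tight : ∀ h s → suc (suc (s * 2 + (h + 3 * (2 + h * 2)))) ≡ 8 + 7 * h + s * 2
tight = solve-∀

-- Each of the at most five links has a segment of its own, so slot 0 serves for all.
layout-small : ∀ {h} → h ≤ 3 → Layout h (8 + 7 * h) (40 + 35 * h)
layout-small {h} h≤3 = record
  { seg = id ; slot = λ _ → 0
  ; fits = λ _ → ≤-reflexive (trans (tight h 0) (+-identityʳ (8 + 7 * h)))
  ; inside = λ {j} j≤ → ≤-trans (≤-trans (≤-reflexive (sym (+-suc (j * W) _)))
      (+-mono-≤ (*-monoˡ-≤ W (≤-trans j≤ (s≤s h≤3))) (≤-trans (n≤1+n _) (≤-reflexive (trans (tight h 0) (+-identityʳ W))))))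
      (≤-reflexive (total h))
  ; small = λ _ → inj₁ refl
  ; determined = λ _ _ eq _ → eq
  ; alternate = λ j≤ → nxt≢ j≤ }
  where
  W = 8 + 7 * h

  total : ∀ h → 4 * (8 + 7 * h) + (8 + 7 * h) ≡ 40 + 35 * h
  total = solve-∀

  nxt≢ : ∀ {j} → j ≤ suc h → nxt (suc h) j ≢ j
  nxt≢ {j} j≤ with j ≟ suc h
  ... | yes refl = λ ()
  ... | no _     = 1+n≢n

-- Cancelling equal residues would make one multiple of 3 the successor of another.
1+n%3≢n%3 : ∀ n → suc n % 3 ≢ n % 3
1+n%3≢n%3 n eq = contradiction (proj₂ (euclid (suc n / 3) (n / 3) {0} {1} (s≤s z≤n) (s≤s (s≤s z≤n))
  (+-cancelˡ-≡ (n % 3) _ _ (begin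
    n % 3 + (suc n / 3 * 3 + 0)  ≡⟨ cong₂ _+_ (sym eq) (+-identityʳ _) ⟩
    suc n % 3 + suc n / 3 * 3    ≡⟨ sym (m≡m%n+[m/n]*n (suc n) 3) ⟩
    suc n                        ≡⟨ cong suc (m≡m%n+[m/n]*n n 3) ⟩
    suc (n % 3 + n / 3 * 3)      ≡⟨ shuffle (n % 3) (n / 3 * 3) ⟩
    n % 3 + (n / 3 * 3 + 1)      ∎)))) λ ()
  where
  open ≡-Reasoning
  shuffle : ∀ a b → suc (a + b) ≡ a + (b + 1)
  shuffle = solve-∀

-- Three segments in rotation and a fourth for the closing link. For h = 3 two links in one
-- segment would collide, hence the separate layout for small h.
layout-large : ∀ {h} → 4 ≤ h → Layout h (8 + 7 * h + h / 3 * 2) (32 + 28 * h + h / 3 * 6)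
layout-large {h} 4≤h = record
  { seg = seg ; slot = slot
  ; fits = λ {j} j≤ → ≤-trans (≤-reflexive (tight h (slot j)))
      (+-monoʳ-≤ (8 + 7 * h) (*-monoˡ-≤ 2 (slot≤ j)))
  ; inside = λ {j} → inside j
  ; small = λ {j} → small j
  ; determined = λ {i} {j} → determined i j
  ; alternate = λ {j} → alternate j }
  where
  W = 8 + 7 * h + h / 3 * 2

  seg slot : ℕ → ℕ
  seg j with j ≤? h
  ... | yes _ = j % 3
  ... | no _  = 3
  slot j with j ≤? h
  ... | yes _ = j / 3
  ... | no _  = 0

  slot≤ : ∀ j → slot j ≤ h / 3
  slot≤ j with j ≤? h
  ... | yes j≤h = /-monoˡ-≤ 3 j≤h
  ... | no _    = z≤n

  inside : ∀ j → j ≤ suc h → seg j * W + (slot j * 2 + (h + 3 * (2 + h * 2))) < 32 + 28 * h + h / 3 * 6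
  inside j j≤ with j ≤? h
  ... | yes j≤h = ≤-trans (≤-reflexive (sym (+-suc (j % 3 * W) _))) (≤-trans
    (+-mono-≤ (*-monoˡ-≤ W (s≤s⁻¹ (m%n<n j 3)))
      (≤-trans (n≤1+n _) (≤-trans (≤-reflexive (tight h (j / 3))) (+-monoʳ-≤ (8 + 7 * h) (*-monoˡ-≤ 2 (/-monoˡ-≤ 3 j≤h))))))
    (≤-trans (m≤m+n _ (8 + 7 * h)) (≤-reflexive (total h (h / 3)))))
    where
    total : ∀ h s → 2 * (8 + 7 * h + s * 2) + (8 + 7 * h + s * 2) + (8 + 7 * h) ≡ 32 + 28 * h + s * 6
    total = solve-∀
  -- The closing link has slot 0, so the fourth segment can stop after `8 + 7h` vertices and the
  -- path length is `3W + 8 + 7h`.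
  ... | no _ = ≤-trans (n≤1+n _) (≤-reflexive (total h (h / 3)))
    where
    total : ∀ h s → 2 + (3 * (8 + 7 * h + s * 2) + (h + 3 * (2 + h * 2))) ≡ 32 + 28 * h + s * 6
    total = solve-∀

  spaced : ∀ s → s * 3 ≤ h → s ≡ 0 ⊎ 2 + s * 2 ≤ h
  spaced zero          _  = inj₁ refl
  -- Slot 1 requires `4 ≤ h`; from slot 2 on, `2 + 2s ≤ 3s` is enough.
  spaced (suc zero)    _  = inj₂ 4≤h
  spaced (suc (suc s)) le = inj₂ (≤-trans (+-monoʳ-≤ 6 (*-monoʳ-≤ s (n≤1+n 2))) le)

  small : ∀ j → j ≤ suc h → slot j ≡ 0 ⊎ 2 + slot j * 2 ≤ h
  small j _ with j ≤? h
  ... | yes j≤h = spaced (j / 3) (≤-trans (m/n*n≤m j 3) j≤h)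
  ... | no _    = inj₁ refl

  determined : ∀ i j → i ≤ suc h → j ≤ suc h → seg i ≡ seg j → slot i ≡ slot j → i ≡ j
  determined i j i≤ j≤ seg≡ slot≡ with i ≤? h | j ≤? h
  ... | yes _   | yes _   = trans (m≡m%n+[m/n]*n i 3)
    (trans (cong₂ (λ a b → a + b * 3) seg≡ slot≡) (sym (m≡m%n+[m/n]*n j 3)))
  ... | yes _   | no _    = contradiction (m%n<n i 3) (≤⇒≯ (≤-reflexive (sym seg≡)))
  ... | no _    | yes _   = contradiction (m%n<n j 3) (≤⇒≯ (≤-reflexive seg≡))
  ... | no i≰h  | no j≰h  = trans (≤-antisym i≤ (≰⇒> i≰h)) (≤-antisym (≰⇒> j≰h) j≤)

  alternate : ∀ j → j ≤ suc h → seg (nxt (suc h) j) ≢ seg j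
  alternate j j≤ with j ≟ suc h
  ... | yes refl with suc h ≤? h
  ...   | yes 1+h≤h = contradiction 1+h≤h 1+n≰n
  ...   | no _      = λ ()
  alternate j j≤ | no j≢ with suc j ≤? h | j ≤? h
  ...   | yes _ | yes _  = 1+n%3≢n%3 j
  ...   | yes j<h | no j≰h = contradiction (<⇒≤ j<h) j≰h
  ...   | no _ | yes _  = λ eq → contradiction (m%n<n j 3) (≤⇒≯ (≤-reflexive eq))
  ...   | no _ | no j≰h = contradiction (≤-antisym j≤ (≰⇒> j≰h)) j≢

-- The total number of edges

ramsey-even : ∀ h → IndOnlineRamseyCycle≤ (4 + h * 2) (367 * (4 + h * 2) ∸ 27)
ramsey-even h with h ≤? 3
-- Subtraction is truncated, so 27 is added to the cost instead. For `h ≤ 3` the excess `116 h` is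
-- at most 348.
... | yes h≤3 = weaken (m+n≤o⇒m≤o∸n _ (≤-trans (≤-reflexive (cost h))
    (≤-trans (+-monoʳ-≤ (999 + 734 * h) (*-monoʳ-≤ 116 h≤3)) (≤-trans (m≤m+n _ 121) (≤-reflexive (budget h))))))
  (force-path (39 + 35 * h) λ two path below bounded loopless →
    Strategy.win h two path below bounded loopless (layout-small h≤3))
  where
  cost : ∀ h → (3 * (39 + 35 * h) + 2) * 8 + (suc (suc h) * 4 + (suc (suc h) * 6 + 0)) + 27 ≡ 999 + 734 * h + 116 * h
  cost = solve-∀

  budget : ∀ h → 999 + 734 * h + 348 + 121 ≡ 367 * (4 + h * 2)
  budget = solve-∀
-- The term in `h / 3` costs at most `48 h`, because `h / 3 * 3 ≤ h`.
... | no h≰3 = weaken (m+n≤o⇒m≤o∸n _ (≤-trans (≤-reflexive (cost h (h / 3)))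
    (≤-trans (+-monoʳ-≤ (807 + 682 * h) (*-monoʳ-≤ 48 (m/n*n≤m h 3)))
      (≤-trans (m≤m+n _ (661 + 4 * h)) (≤-reflexive (budget h))))))
  (force-path (31 + 28 * h + h / 3 * 6) λ two path below bounded loopless →
    Strategy.win h two path below bounded loopless (layout-large (≰⇒> h≰3)))
  where
  cost : ∀ h s → (3 * (31 + 28 * h + s * 6) + 2) * 8 + (suc (suc h) * 4 + (suc (suc h) * 6 + 0)) + 27
    ≡ 807 + 682 * h + 48 * (s * 3)
  cost = solve-∀

  budget : ∀ h → 807 + 682 * h + 48 * h + (661 + 4 * h) ≡ 367 * (4 + h * 2)
  budget = solve-∀

theorem3 : (n : ℕ) → 4 ≤ n → 2 ∣ n →
    IndOnlineRamseyCycle≤ n (367 * n ∸ 27)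
theorem3 n 4≤n (divides (suc (suc h)) refl) = ramsey-even h
theorem3 n (s≤s (s≤s ())) (divides (suc zero) refl)
theorem3 n () (divides zero refl)
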